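{- $\mathbf{JIDL_1}=\mathbf{DStHC}\vee\mathbf{V(D_2)}$, where the join is taken in the lattice of subvarieties of $\mathbf{DQD}$ and $\mathbf{V(D_2)}$ is the variety generated by $\mathbf{D_2}$.
   Context: A semi-Heyting algebra is an algebra $\langle L,\vee,\wedge,\to,0,1\rangle$ such that $\langle L,\vee,\wedge,0,1\rangle$ is a bounded lattice and the identities $x\wedge(x\to y)\approx x\wedge y$, $x\wedge(y\to z)\approx x\wedge[(x\wedge y)\to(x\wedge z)]$, $x\to x\approx 1$ hold; it is a Heyting algebra if moreover $(x\wedge y)\to y\approx 1$. Write $x^*:=x\to 0$. A $\mathbf{DQD}$-algebra (dually quasi-De Morgan semi-Heyting algebra) is an algebra $\langle L,\vee,\wedge,\to,{}',0,1\rangle$ whose reduct $\langle L,\vee,\wedge,\to,0,1\rangle$ is a semi-Heyting algebra and which satisfies: $0'\approx 1$ and $1'\approx 0$; $(x\wedge y)'\approx x'\vee y'$; $(x\vee y)''\approx x''\vee y''$; $x''\le x$. $\mathbf{DQD}$ denotes the variety of all $\mathbf{DQD}$-algebras. $\mathbf{JIDL_1}$ is the subvariety of $\mathbf{DQD}$ defined by the identities $x'\vee(y\to z)\approx(x'\vee y)\to(x'\vee z)$, $(x\to y)\vee(y\to x)\approx 1$, and $x\wedge x'^{*}\approx (x\wedge x'^{*})'^{*}$ (where $z'^*$ means $(z')^*$); in the presence of the first identity, the last is equivalent to the level-1 identity $x\wedge x'^*\approx x\wedge x'^*\wedge x'^*{}'^*$. A dually Stone Heyting chain is a $\mathbf{DQD}$-algebra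 satisfying $x'\wedge x''\approx 0$ whose semi-Heyting reduct is a Heyting algebra and whose lattice reduct is a chain; $\mathbf{DStHC}$ is the variety generated by all dually Stone Heyting chains. $\mathbf{D_2}$ is the $\mathbf{DQD}$-algebra whose reduct without $'$ is the four-element Boolean algebra $\{0,a,b,1\}$ with its Heyting implication ($x\to y$ is the join of the complement of $x$ with $y$), and with $0'=1$, $1'=0$, $a'=a$, $b'=b$. -}

module Defs where

open import Level using (Level; 0ℓ; suc; _⊔_; Lift; lift; lower)
open import Algebra.Core using (Op₁; Op₂)
open import Algebra.Definitions using (RightIdentity; Congruent₁; Congruent₂)
open import Algebra.Lattice.Structures using (IsLattice)
open import Data.Bool.Base using (Bool; true; false) renaming (_∧_ to _∧ᵇ_; _∨_ to _∨ᵇ_; not to notᵇ)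
import Data.Bool.Properties as 𝔹
open import Data.Nat.Base using (ℕ)
open import Data.Product.Base using (_×_; _,_; ∃-syntax; proj₁; proj₂)
open import Data.Sum.Base using (inj₁; inj₂)
open import Relation.Binary.Core using (Rel)
open import Relation.Binary.Definitions using (Total)
open import Relation.Binary.PropositionalEquality using (_≡_; refl; sym; trans; cong; cong₂)
open import Relation.Unary using (Pred; _∈_; _⊆_; _∪_; _≐_; ｛_｝)

private variable
  c ℓ i p q r : Level

record IsSemiHeytingAlgebra {A : Set c} (_≈_ : Rel A ℓ) (_∨_ _∧_ _⇒_ : Op₂ A) (0# 1# : A) : Set (c ⊔ ℓ) where
  field
    isLattice    : IsLattice _≈_ _∨_ _∧_
    ∨-identityʳ  : RightIdentity _≈_ 0# _∨_
    ∧-identityʳ  : RightIdentity _≈_ 1# _∧_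
    ⇒-cong       : Congruent₂ _≈_ _⇒_
    x∧[x⇒y]≈x∧y  : ∀ x y → (x ∧ (x ⇒ y)) ≈ (x ∧ y)
    x∧[y⇒z]      : ∀ x y z → (x ∧ (y ⇒ z)) ≈ (x ∧ ((x ∧ y) ⇒ (x ∧ z)))
    x⇒x≈1        : ∀ x → (x ⇒ x) ≈ 1#

  open IsLattice isLattice public

record IsDQDAlgebra {A : Set c} (_≈_ : Rel A ℓ) (_∨_ _∧_ _⇒_ : Op₂ A) (_′ : Op₁ A) (0# 1# : A) : Set (c ⊔ ℓ) where
  field
    isSemiHeytingAlgebra : IsSemiHeytingAlgebra _≈_ _∨_ _∧_ _⇒_ 0# 1#
    ′-cong               : Congruent₁ _≈_ _′
    0′≈1                 : (0# ′) ≈ 1#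
    1′≈0                 : (1# ′) ≈ 0#
    [x∧y]′≈x′∨y′         : ∀ x y → ((x ∧ y) ′) ≈ ((x ′) ∨ (y ′))
    [x∨y]″≈x″∨y″         : ∀ x y → (((x ∨ y) ′) ′) ≈ (((x ′) ′) ∨ ((y ′) ′))
    x″≤x                 : ∀ x → (((x ′) ′) ∧ x) ≈ ((x ′) ′)

  open IsSemiHeytingAlgebra isSemiHeytingAlgebra public

record DQDAlgebra (c ℓ : Level) : Set (suc (c ⊔ ℓ)) where
  infixl 9 _′
  infixr 7 _∧_
  infixr 6 _∨_
  infixr 5 _⇒_
  infix  4 _≈_ _≤_
  field
    Carrier      : Set c
    _≈_          : Rel Carrier ℓ
    _∨_ _∧_ _⇒_  : Op₂ Carrier
    _′           : Op₁ Carrier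
    0# 1#        : Carrier
    isDQDAlgebra : IsDQDAlgebra _≈_ _∨_ _∧_ _⇒_ _′ 0# 1#

  open IsDQDAlgebra isDQDAlgebra public renaming (refl to ≈-refl; sym to ≈-sym; trans to ≈-trans)

  _≤_ : Rel Carrier ℓ
  x ≤ y = x ∧ y ≈ x

infixl 9 _′ₜ _*ₜ
infixr 7 _∧ₜ_
infixr 6 _∨ₜ_
infixr 5 _⇒ₜ_
infix  4 _≈ₜ_

data Term : Set where
  var             : ℕ → Term
  _∨ₜ_ _∧ₜ_ _⇒ₜ_  : Op₂ Term
  _′ₜ             : Op₁ Term
  0ₜ 1ₜ           : Term

_*ₜ : Op₁ Term
t *ₜ = t ⇒ₜ 0ₜ

record Identity : Set where
  constructor _≈ₜ_
  field
    lhs rhs : Term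

module _ (A : DQDAlgebra c ℓ) where
  open DQDAlgebra A

  ⟦_⟧ : Term → (ℕ → Carrier) → Carrier
  ⟦ var n  ⟧ ρ = ρ n
  ⟦ s ∨ₜ t ⟧ ρ = ⟦ s ⟧ ρ ∨ ⟦ t ⟧ ρ
  ⟦ s ∧ₜ t ⟧ ρ = ⟦ s ⟧ ρ ∧ ⟦ t ⟧ ρ
  ⟦ s ⇒ₜ t ⟧ ρ = ⟦ s ⟧ ρ ⇒ ⟦ t ⟧ ρ
  ⟦ t ′ₜ   ⟧ ρ = ⟦ t ⟧ ρ ′
  ⟦ 0ₜ     ⟧ ρ = 0#
  ⟦ 1ₜ     ⟧ ρ = 1#

  infix 4 _⊨_
  _⊨_ : Identity → Set (c ⊔ ℓ)
  _⊨_ (s ≈ₜ t) = ∀ ρ → ⟦ s ⟧ ρ ≈ ⟦ t ⟧ ρ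

Mod : Pred Identity i → Pred (DQDAlgebra c ℓ) (c ⊔ ℓ ⊔ i)
Mod Γ A = ∀ e → e ∈ Γ → A ⊨ e

-- Every algebra considered is a DQD-algebra, so these are the subvarieties
-- of DQD, ordered by _⊆_.
IsVariety : ∀ i → Pred (DQDAlgebra c ℓ) p → Set (suc (c ⊔ ℓ ⊔ i) ⊔ p)
IsVariety i 𝒱 = ∃[ Γ ] 𝒱 ≐ Mod {i = i} Γ

-- The variety generated by 𝒦: the intersection of all varieties containing 𝒦.
-- Only sets of identities at level 0 are quantified over; by V-least below
-- this loses nothing.
V : Pred (DQDAlgebra c ℓ) p → Pred (DQDAlgebra c ℓ) (suc (c ⊔ ℓ) ⊔ p)
V 𝒦 A = (Γ : Pred Identity 0ℓ) → 𝒦 ⊆ Mod Γ → A ∈ Mod Γ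

infixr 6 _∨ᵛ_
_∨ᵛ_ : Pred (DQDAlgebra c ℓ) p → Pred (DQDAlgebra c ℓ) q → Pred (DQDAlgebra c ℓ) (suc (c ⊔ ℓ) ⊔ p ⊔ q)
𝒱 ∨ᵛ 𝒲 = V (𝒱 ∪ 𝒲)

V-contains : (𝒦 : Pred (DQDAlgebra c ℓ) p) → 𝒦 ⊆ V 𝒦
V-contains 𝒦 A∈𝒦 Γ 𝒦⊨Γ = 𝒦⊨Γ A∈𝒦

V-isVariety : (𝒦 : Pred (DQDAlgebra c ℓ) p) → IsVariety (suc (c ⊔ ℓ) ⊔ p) (V 𝒦)
V-isVariety 𝒦 =
  (λ e → ∀ {B} → B ∈ 𝒦 → B ⊨ e) ,
  (λ A∈V e 𝒦⊨e → A∈V ｛ e ｝ (λ { B∈𝒦 _ refl → 𝒦⊨e B∈𝒦 }) e refl) ,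
  (λ A⊨Th Γ 𝒦⊨Γ e e∈Γ → A⊨Th e (λ B∈𝒦 → 𝒦⊨Γ B∈𝒦 e e∈Γ))

V-least : (𝒦 : Pred (DQDAlgebra c ℓ) p) (𝒱 : Pred (DQDAlgebra c ℓ) q) →
          IsVariety i 𝒱 → 𝒦 ⊆ 𝒱 → V 𝒦 ⊆ 𝒱
V-least 𝒦 𝒱 (Γ , 𝒱⊆Mod , Mod⊆𝒱) 𝒦⊆𝒱 A∈V =
  Mod⊆𝒱 (λ e e∈Γ → A∈V ｛ e ｝ (λ { B∈𝒦 _ refl → 𝒱⊆Mod (𝒦⊆𝒱 B∈𝒦) e e∈Γ }) e refl)

∨ᵛ-upperˡ : (𝒱 : Pred (DQDAlgebra c ℓ) p) (𝒲 : Pred (DQDAlgebra c ℓ) q) → 𝒱 ⊆ 𝒱 ∨ᵛ 𝒲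
∨ᵛ-upperˡ 𝒱 𝒲 A∈𝒱 = V-contains (𝒱 ∪ 𝒲) (inj₁ A∈𝒱)

∨ᵛ-upperʳ : (𝒱 : Pred (DQDAlgebra c ℓ) p) (𝒲 : Pred (DQDAlgebra c ℓ) q) → 𝒲 ⊆ 𝒱 ∨ᵛ 𝒲
∨ᵛ-upperʳ 𝒱 𝒲 A∈𝒲 = V-contains (𝒱 ∪ 𝒲) (inj₂ A∈𝒲)

∨ᵛ-least : (𝒱 : Pred (DQDAlgebra c ℓ) p) (𝒲 : Pred (DQDAlgebra c ℓ) q) (𝒰 : Pred (DQDAlgebra c ℓ) r) →
           IsVariety i 𝒰 → 𝒱 ⊆ 𝒰 → 𝒲 ⊆ 𝒰 → 𝒱 ∨ᵛ 𝒲 ⊆ 𝒰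
∨ᵛ-least 𝒱 𝒲 𝒰 𝒰-var 𝒱⊆𝒰 𝒲⊆𝒰 =
  V-least (𝒱 ∪ 𝒲) 𝒰 𝒰-var λ { (inj₁ A∈𝒱) → 𝒱⊆𝒰 A∈𝒱 ; (inj₂ A∈𝒲) → 𝒲⊆𝒰 A∈𝒲 }

private
  x y z : Term
  x = var 0
  y = var 1
  z = var 2

data JIDL₁-Identities : Pred Identity 0ℓ where
  ′-∨-distrib-⇒ : JIDL₁-Identities (x ′ₜ ∨ₜ (y ⇒ₜ z) ≈ₜ (x ′ₜ ∨ₜ y) ⇒ₜ (x ′ₜ ∨ₜ z))
  prelinear     : JIDL₁-Identities ((x ⇒ₜ y) ∨ₜ (y ⇒ₜ x) ≈ₜ 1ₜ)
  level-1       : JIDL₁-Identities (x ∧ₜ x ′ₜ *ₜ ≈ₜ (x ∧ₜ x ′ₜ *ₜ) ′ₜ *ₜ)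

JIDL₁ : Pred (DQDAlgebra c ℓ) (c ⊔ ℓ)
JIDL₁ = Mod JIDL₁-Identities

record IsDuallyStoneHeytingChain (A : DQDAlgebra c ℓ) : Set (c ⊔ ℓ) where
  open DQDAlgebra A
  field
    duallyStone : ∀ x → x ′ ∧ x ′ ′ ≈ 0#
    heyting     : ∀ x y → (x ∧ y) ⇒ y ≈ 1#
    chain       : Total _≤_

DStHC : Pred (DQDAlgebra c ℓ) (suc (c ⊔ ℓ))
DStHC = V IsDuallyStoneHeytingChain

-- The four-element Boolean algebra is presented as Bool × Bool:
-- 0 = (false , false), a = (true , false), b = (false , true), 1 = (true , true).
module Four where

  infixr 7 _∧_
  infixr 6 _∨_
  infixr 5 _⇒_

  Carrier : Set
  Carrier = Bool × Bool

  pattern 𝟘 = false , false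
  pattern a = true  , false
  pattern b = false , true
  pattern 𝟙 = true  , true

  _∨_ _∧_ _⇒_ : Op₂ Carrier
  (p , q) ∨ (r , s) = p ∨ᵇ r , q ∨ᵇ s
  (p , q) ∧ (r , s) = p ∧ᵇ r , q ∧ᵇ s

  complement : Op₁ Carrier
  complement (p , q) = notᵇ p , notᵇ q

  x ⇒ y = complement x ∨ y

  _′ : Op₁ Carrier
  𝟘 ′ = 𝟙
  a ′ = a
  b ′ = b
  𝟙 ′ = 𝟘

  private
    -- In coordinates _′ swaps and negates.
    ′-swap : ∀ x → x ′ ≡ (notᵇ (proj₂ x) , notᵇ (proj₁ x))
    ′-swap 𝟘 = refl
    ′-swap a = refl
    ′-swap b = refl
    ′-swap 𝟙 = refl

    ′-involutive : ∀ x → (x ′) ′ ≡ x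
    ′-involutive 𝟘 = refl
    ′-involutive a = refl
    ′-involutive b = refl
    ′-involutive 𝟙 = refl

    not-∧ : ∀ p q → notᵇ (p ∧ᵇ q) ≡ notᵇ p ∨ᵇ notᵇ q
    not-∧ false q = refl
    not-∧ true  q = refl

    de-morgan : ∀ x y → (x ∧ y) ′ ≡ (x ′) ∨ (y ′)
    de-morgan x@(p , q) y@(r , s) =
      trans (′-swap (x ∧ y))
        (trans (cong₂ _,_ (not-∧ q s) (not-∧ p r))
          (sym (cong₂ _∨_ (′-swap x) (′-swap y))))

    modus-ponens : ∀ p q → p ∧ᵇ (notᵇ p ∨ᵇ q) ≡ p ∧ᵇ q
    modus-ponens false q = refl
    modus-ponens true  q = refl

    relativise : ∀ p q r → p ∧ᵇ (notᵇ q ∨ᵇ r) ≡ p ∧ᵇ (notᵇ (p ∧ᵇ q) ∨ᵇ (p ∧ᵇ r))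
    relativise false q r = refl
    relativise true  q r = refl

  isLattice : IsLattice _≡_ _∨_ _∧_
  isLattice = record
    { isEquivalence = record { refl = refl ; sym = sym ; trans = trans }
    ; ∨-comm        = λ (p , q) (r , s) → cong₂ _,_ (𝔹.∨-comm p r) (𝔹.∨-comm q s)
    ; ∨-assoc       = λ (p , q) (r , s) (t , u) → cong₂ _,_ (𝔹.∨-assoc p r t) (𝔹.∨-assoc q s u)
    ; ∨-cong        = cong₂ _∨_
    ; ∧-comm        = λ (p , q) (r , s) → cong₂ _,_ (𝔹.∧-comm p r) (𝔹.∧-comm q s)
    ; ∧-assoc       = λ (p , q) (r , s) (t , u) → cong₂ _,_ (𝔹.∧-assoc p r t) (𝔹.∧-assoc q s u)
    ; ∧-cong        = cong₂ _∧_
    ; absorptive    = (λ (p , q) (r , s) → cong₂ _,_ (𝔹.∨-abs-∧ p r) (𝔹.∨-abs-∧ q s))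
                    , (λ (p , q) (r , s) → cong₂ _,_ (𝔹.∧-abs-∨ p r) (𝔹.∧-abs-∨ q s))
    }

  isDQDAlgebra : IsDQDAlgebra _≡_ _∨_ _∧_ _⇒_ _′ 𝟘 𝟙
  isDQDAlgebra = record
    { isSemiHeytingAlgebra = record
      { isLattice   = isLattice
      ; ∨-identityʳ = λ (p , q) → cong₂ _,_ (𝔹.∨-identityʳ p) (𝔹.∨-identityʳ q)
      ; ∧-identityʳ = λ (p , q) → cong₂ _,_ (𝔹.∧-identityʳ p) (𝔹.∧-identityʳ q)
      ; ⇒-cong      = cong₂ _⇒_
      ; x∧[x⇒y]≈x∧y = λ (p , q) (r , s) → cong₂ _,_ (modus-ponens p r) (modus-ponens q s)
      ; x∧[y⇒z]     = λ (p , q) (r , s) (t , u) → cong₂ _,_ (relativise p r t) (relativise q s u)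
      ; x⇒x≈1       = λ (p , q) → cong₂ _,_ (𝔹.∨-inverseˡ p) (𝔹.∨-inverseˡ q)
      }
    ; ′-cong       = cong _′
    ; 0′≈1         = refl
    ; 1′≈0         = refl
    ; [x∧y]′≈x′∨y′ = de-morgan
    ; [x∨y]″≈x″∨y″ = λ x y → trans (′-involutive (x ∨ y)) (sym (cong₂ _∨_ (′-involutive x) (′-involutive y)))
    ; x″≤x         = λ x → trans (cong (_∧ x) (′-involutive x)) (trans (∧-idem x) (sym (′-involutive x)))
    }
    where
    ∧-idem : ∀ x → x ∧ x ≡ x
    ∧-idem (p , q) = cong₂ _,_ (𝔹.∧-idem p) (𝔹.∧-idem q)

Lift-algebra : ∀ c ℓ → DQDAlgebra 0ℓ 0ℓ → DQDAlgebra c ℓ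
Lift-algebra c ℓ A = record
  { Carrier      = Lift c Carrier
  ; _≈_          = λ x y → Lift ℓ (lower x ≈ lower y)
  ; _∨_          = λ x y → lift (lower x ∨ lower y)
  ; _∧_          = λ x y → lift (lower x ∧ lower y)
  ; _⇒_          = λ x y → lift (lower x ⇒ lower y)
  ; _′           = λ x → lift (lower x ′)
  ; 0#           = lift 0#
  ; 1#           = lift 1#
  ; isDQDAlgebra = record
    { isSemiHeytingAlgebra = record
      { isLattice = record
        { isEquivalence = record
          { refl  = lift ≈-refl
          ; sym   = λ p → lift (≈-sym (lower p))
          ; trans = λ p q → lift (≈-trans (lower p) (lower q))
          }
        ; ∨-comm     = λ x y → lift (∨-comm _ _)
        ; ∨-assoc    = λ x y z → lift (∨-assoc _ _ _)
        ; ∨-cong     = λ p q → lift (∨-cong (lower p) (lower q))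
        ; ∧-comm     = λ x y → lift (∧-comm _ _)
        ; ∧-assoc    = λ x y z → lift (∧-assoc _ _ _)
        ; ∧-cong     = λ p q → lift (∧-cong (lower p) (lower q))
        ; absorptive = (λ x y → lift (proj₁ absorptive _ _)) , (λ x y → lift (proj₂ absorptive _ _))
        }
      ; ∨-identityʳ = λ x → lift (∨-identityʳ _)
      ; ∧-identityʳ = λ x → lift (∧-identityʳ _)
      ; ⇒-cong      = λ p q → lift (⇒-cong (lower p) (lower q))
      ; x∧[x⇒y]≈x∧y = λ x y → lift (x∧[x⇒y]≈x∧y _ _)
      ; x∧[y⇒z]     = λ x y z → lift (x∧[y⇒z] _ _ _)
      ; x⇒x≈1       = λ x → lift (x⇒x≈1 _)
      }
    ; ′-cong       = λ p → lift (′-cong (lower p))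
    ; 0′≈1         = lift 0′≈1
    ; 1′≈0         = lift 1′≈0
    ; [x∧y]′≈x′∨y′ = λ x y → lift ([x∧y]′≈x′∨y′ _ _)
    ; [x∨y]″≈x″∨y″ = λ x y → lift ([x∨y]″≈x″∨y″ _ _)
    ; x″≤x         = λ x → lift (x″≤x _)
    }
  }
  where open DQDAlgebra A

D₂ : DQDAlgebra c ℓ
D₂ = Lift-algebra _ _ (record { isDQDAlgebra = Four.isDQDAlgebra })

{-# OPTIONS --safe #-}
module Submission where

-- Why the two varieties coincide.
--
-- The inclusion of the join in JIDL₁ is a check on generators. In a dually
-- Stone Heyting chain every x ′ is 0 or 1, which reduces the three
-- identities to trivial cases; in D₂ they are checked by coordinates.
--
-- For the other inclusion, an algebra A in JIDL₁ is analysed through its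
-- central elements: those d for which d ′ is a lattice complement of d. Each
-- of them makes "x ≈ y modulo d", meaning d ∧ x ≈ d ∧ y, a congruence, and A
-- embeds in the product of the quotients by d and by d ′. So an equation may
-- be proved by splitting A along finitely many central elements. Three facts
-- make this effective.
--
--  * Prelinearity forces A to be a Heyting algebra, the first identity forces
--    each x ′ to be complemented by x ′ *, and then the level-1 identity says
--    exactly that x ∧ x ′ * is central. Splitting along these elements for x
--    and for x ′ leaves three possibilities in each piece: x ≈ 1, x ′ ≈ 1, or
--    x ≈ x ′ (locally-all-trichotomous).
--
--  * In a piece where no relevant element is a fixed point of ′, prelinearity
--    makes the generators 0, 1, ρ n a chain that is closed, up to ≈, under all
--    operations, and this chain is dually Stone (ExtremalCase).
--
--  * In a piece with a fixed point a, every relevant element is one of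
--    0, a, a *, 1, and these four are a homomorphic image of D₂ (FixedCase).
--
-- An identity has finitely many variables, so it suffices to settle the
-- trichotomy for a finite list of elements; an identity valid in all dually
-- Stone Heyting chains and in D₂ then holds in every piece and so in A. No
-- prime filters and no subdirect representation are needed, and the argument
-- is constructive.

open import Defs
open import Level using (Level; _⊔_; Lift; lift; lower)
open import Relation.Unary using (_≐_; ｛_｝)
open import Algebra.Lattice.Bundles using (Lattice)
import Algebra.Lattice.Properties.Lattice as LatticeProperties
open import Data.Bool.Base using (true; false) renaming (_∨_ to _∨ᵇ_; not to notᵇ)
open import Data.List.Base using (List; []; _∷_; _++_; [_]; map; cartesianProductWith)
open import Data.List.Membership.Propositional using (_∈_; find)
open import Data.List.Membership.Propositional.Properties
  using (∈-++⁺ˡ; ∈-++⁺ʳ; ∈-map⁺; ∈-cartesianProductWith⁺)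
open import Data.List.Relation.Unary.All as All using (All; []; _∷_)
open import Data.List.Relation.Unary.Any using (Any; here; there)
open import Data.Nat.Base using (ℕ)
import Data.Nat.Properties as ℕ
open import Data.List.Membership.DecPropositional ℕ._≟_ using (_∈?_)
open import Data.Product.Base using (_×_; _,_; ∃-syntax; proj₁; proj₂)
open import Data.Sum.Base as Sum using (_⊎_; inj₁; inj₂)
open import Function.Base using (id; _∘_; _$_)
import Relation.Binary.Lattice as Order
import Relation.Binary.Lattice.Properties.BoundedLattice as BoundedLatticeProperties
import Relation.Binary.Lattice.Properties.DistributiveLattice as DistributiveLatticeProperties
import Relation.Binary.Lattice.Properties.HeytingAlgebra as HeytingAlgebraProperties
import Relation.Binary.Lattice.Properties.JoinSemilattice as JoinSemilatticeProperties
import Relation.Binary.Lattice.Properties.MeetSemilattice as MeetSemilatticeProperties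
open import Relation.Binary.PropositionalEquality using (_≡_; refl; cong₂)
import Relation.Binary.Reasoning.PartialOrder as ≤-Reasoning
open import Relation.Nullary using (yes; no; contradiction)
open import Relation.Unary using (Pred; _⊆_)

private variable
  c ℓ : Level

-- Order and arithmetic in DQD-algebras
--
-- The order is x ≈ x ∧ y, the equation defining DQDAlgebra._≤_ read backwards.
module BoundedLatticeFacts (A : DQDAlgebra c ℓ) where
  open DQDAlgebra A hiding (_≤_)

  lattice : Lattice c ℓ
  lattice = record { isLattice = isLattice }

  open LatticeProperties lattice using (∨-∧-isOrderTheoreticLattice)

  boundedLattice : Order.BoundedLattice c ℓ ℓ
  boundedLattice = record
    { isBoundedLattice = record
      { isLattice = ∨-∧-isOrderTheoreticLattice
      ; maximum   = λ x → ≈-sym (∧-identityʳ x)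
      ; minimum   = λ x → ≈-sym (≈-trans (∧-congˡ (≈-sym (≈-trans (∨-comm 0# x) (∨-identityʳ x)))) (∧-absorbs-∨ 0# x))
      }
    }

  open Order.BoundedLattice boundedLattice public
    using (_≤_; poset; antisym; maximum; minimum;
           x≤x∨y; y≤x∨y; ∨-least; x∧y≤x; x∧y≤y; ∧-greatest)
    renaming (refl to ≤-refl; trans to ≤-trans; reflexive to ≤-reflexive)
  open BoundedLatticeProperties boundedLattice public
    using (∧-zeroˡ; ∧-zeroʳ; ∨-zeroˡ; ∨-zeroʳ)
  open LatticeProperties lattice public using (∧-idem; ∨-idem)
  open JoinSemilatticeProperties (Order.BoundedLattice.joinSemilattice boundedLattice) public using (∨-monotonic)
  open MeetSemilatticeProperties (Order.BoundedLattice.meetSemilattice boundedLattice) public using (∧-monotonic)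

  ∧-identityˡ : ∀ x → 1# ∧ x ≈ x
  ∧-identityˡ x = ≈-trans (∧-comm 1# x) (∧-identityʳ x)

  ∨-identityˡ : ∀ x → 0# ∨ x ≈ x
  ∨-identityˡ x = ≈-trans (∨-comm 0# x) (∨-identityʳ x)

  1≤⇒≈1 : ∀ {x} → 1# ≤ x → x ≈ 1#
  1≤⇒≈1 1≤x = antisym (maximum _) 1≤x

  ≤0⇒≈0 : ∀ {x} → x ≤ 0# → x ≈ 0#
  ≤0⇒≈0 x≤0 = antisym x≤0 (minimum _)

  ≤⇒∨≈ : ∀ {x y} → x ≤ y → x ∨ y ≈ y
  ≤⇒∨≈ x≤y = antisym (∨-least x≤y ≤-refl) (y≤x∨y _ _)

  ′-antitone : ∀ {x y} → x ≤ y → y ′ ≤ x ′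
  ′-antitone {x} {y} x≤y = ≤-trans (y≤x∨y (x ′) (y ′))
    (≤-reflexive (≈-trans (≈-sym ([x∧y]′≈x′∨y′ x y)) (′-cong (≈-sym x≤y))))

  ″-deflationary : ∀ x → x ′ ′ ≤ x
  ″-deflationary x = ≈-sym (x″≤x x)

  x‴≈x′ : ∀ x → x ′ ′ ′ ≈ x ′
  x‴≈x′ x = antisym (″-deflationary (x ′)) (′-antitone (″-deflationary x))

  1″≈1 : 1# ′ ′ ≈ 1#
  1″≈1 = ≈-trans (′-cong 1′≈0) 0′≈1

  x′≈1⇒x″≈0 : ∀ {x} → x ′ ≈ 1# → x ′ ′ ≈ 0#
  x′≈1⇒x″≈0 x′≈1 = ≈-trans (′-cong x′≈1) 1′≈0

  -- An element y with y ′ ≈ 1 is negligible in joins equal to 1: applying ″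
  -- kills y and, being deflationary, leaves a lower bound of x.
  x∨y≈1⇒x≈1 : ∀ {x y} → y ′ ≈ 1# → x ∨ y ≈ 1# → x ≈ 1#
  x∨y≈1⇒x≈1 {x} {y} y′≈1 x∨y≈1 = 1≤⇒≈1 $ begin
    1#             ≈⟨ 1″≈1 ⟨
    1# ′ ′         ≈⟨ ′-cong (′-cong x∨y≈1) ⟨
    (x ∨ y) ′ ′    ≈⟨ [x∨y]″≈x″∨y″ x y ⟩
    x ′ ′ ∨ y ′ ′  ≈⟨ ∨-congˡ (x′≈1⇒x″≈0 y′≈1) ⟩
    x ′ ′ ∨ 0#     ≈⟨ ∨-identityʳ _ ⟩
    x ′ ′          ≤⟨ ″-deflationary x ⟩
    x              ∎
    where open ≤-Reasoning poset

-- The semi-Heyting reduct is a Heyting algebra.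
IsHeyting : DQDAlgebra c ℓ → Set _
IsHeyting A = ∀ x y → (x ∧ y) ⇒ y ≈ 1#
  where open DQDAlgebra A

module HeytingFacts (A : DQDAlgebra c ℓ) (heyting : IsHeyting A) where
  open DQDAlgebra A hiding (_≤_)
  open BoundedLatticeFacts A

  heytingAlgebra : Order.HeytingAlgebra c ℓ ℓ
  heytingAlgebra = record
    { isHeytingAlgebra = record
      { isBoundedLattice = Order.BoundedLattice.isBoundedLattice boundedLattice
      ; exponential      = λ w x y → residual w x y , residual⁻¹ w x y
      }
    }
    where
    open ≤-Reasoning poset

    residual : ∀ w x y → w ∧ x ≤ y → w ≤ x ⇒ y
    residual w x y w∧x≤y = begin
      w                          ≈⟨ ∧-identityʳ w ⟨
      w ∧ 1#                     ≈⟨ ∧-congˡ (heyting (w ∧ x) (w ∧ y)) ⟨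
      w ∧ ((w ∧ x) ∧ (w ∧ y) ⇒ w ∧ y) ≈⟨ ∧-congˡ (⇒-cong w∧x≤w∧y ≈-refl) ⟨
      w ∧ (w ∧ x ⇒ w ∧ y)        ≈⟨ x∧[y⇒z] w x y ⟨
      w ∧ (x ⇒ y)                ≤⟨ x∧y≤y _ _ ⟩
      x ⇒ y                      ∎
      where
      w∧x≤w∧y : w ∧ x ≤ w ∧ y
      w∧x≤w∧y = ∧-greatest (x∧y≤x w x) w∧x≤y

    residual⁻¹ : ∀ w x y → w ≤ x ⇒ y → w ∧ x ≤ y
    residual⁻¹ w x y w≤x⇒y = begin
      w ∧ x        ≤⟨ ∧-monotonic w≤x⇒y ≤-refl ⟩
      (x ⇒ y) ∧ x  ≈⟨ ∧-comm _ _ ⟩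
      x ∧ (x ⇒ y)  ≈⟨ x∧[x⇒y]≈x∧y x y ⟩
      x ∧ y        ≤⟨ x∧y≤y x y ⟩
      y            ∎

  open Order.HeytingAlgebra heytingAlgebra public using (transpose-⇨; transpose-∧)
  open HeytingAlgebraProperties heytingAlgebra public
    using (y≤x⇨y; ∧-distribˡ-∨; distributiveLattice)
  open DistributiveLatticeProperties distributiveLattice public using (∧-distribʳ-∨)

  infixl 9 _*
  _* : Carrier → Carrier
  x * = x ⇒ 0#

  x∧x*≈0 : ∀ x → x ∧ x * ≈ 0#
  x∧x*≈0 x = ≈-trans (x∧[x⇒y]≈x∧y x 0#) (∧-zeroʳ x)

  disjoint⇒≤* : ∀ {x y} → x ∧ y ≈ 0# → x ≤ y *
  disjoint⇒≤* x∧y≈0 = transpose-⇨ (≤-reflexive x∧y≈0)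

  ⇒≈1⇒≤ : ∀ {x y} → x ⇒ y ≈ 1# → x ≤ y
  ⇒≈1⇒≤ {x} {y} x⇒y≈1 = ≤-trans (≤-reflexive (≈-sym (∧-identityˡ x))) (transpose-∧ (≤-reflexive (≈-sym x⇒y≈1)))

  ≤⇒⇒≈1 : ∀ {x y} → x ≤ y → x ⇒ y ≈ 1#
  ≤⇒⇒≈1 {x} x≤y = 1≤⇒≈1 (transpose-⇨ (≤-trans (x∧y≤y 1# x) x≤y))

  1⇒y≈y : ∀ y → 1# ⇒ y ≈ y
  1⇒y≈y y = ≈-trans (≈-sym (∧-identityˡ _)) (≈-trans (x∧[x⇒y]≈x∧y 1# y) (∧-identityˡ y))

  -- Distributivity in the form of a cancellation: the part of a join that is
  -- disjoint from x can be dropped from an upper bound of x.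
  x≤y∨z⇒x≤y : ∀ {x y z} → x ≤ y ∨ z → x ∧ z ≈ 0# → x ≤ y
  x≤y∨z⇒x≤y {x} {y} {z} x≤y∨z x∧z≈0 = begin
    x                    ≈⟨ x≤y∨z ⟩
    x ∧ (y ∨ z)          ≈⟨ ∧-distribˡ-∨ x y z ⟩
    (x ∧ y) ∨ (x ∧ z)    ≈⟨ ∨-congˡ x∧z≈0 ⟩
    (x ∧ y) ∨ 0#         ≈⟨ ∨-identityʳ _ ⟩
    x ∧ y                ≤⟨ x∧y≤y x y ⟩
    y                    ∎
    where open ≤-Reasoning poset

  complement-unique : ∀ {x y} → x ∨ y ≈ 1# → x ∧ y ≈ 0# → x * ≈ y
  complement-unique {x} {y} x∨y≈1 x∧y≈0 = antisym
    (x≤y∨z⇒x≤y (≤-trans (maximum _) (≤-reflexive (≈-sym (≈-trans (∨-comm y x) x∨y≈1)))) (≈-trans (∧-comm _ _) (x∧x*≈0 x)))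
    (disjoint⇒≤* (≈-trans (∧-comm y x) x∧y≈0))

  complemented-⇒ : ∀ {x} y → x ∨ x * ≈ 1# → x ⇒ y ≈ x * ∨ y
  complemented-⇒ {x} y x∨x*≈1 = antisym
    (begin
      x ⇒ y                              ≈⟨ ∧-identityʳ _ ⟨
      (x ⇒ y) ∧ 1#                       ≈⟨ ∧-congˡ x∨x*≈1 ⟨
      (x ⇒ y) ∧ (x ∨ x *)                ≈⟨ ∧-distribˡ-∨ _ _ _ ⟩
      ((x ⇒ y) ∧ x) ∨ ((x ⇒ y) ∧ x *)    ≤⟨ ∨-least (≤-trans (transpose-∧ ≤-refl) (y≤x∨y _ _)) (≤-trans (x∧y≤y _ _) (x≤x∨y _ _)) ⟩
      x * ∨ y                            ∎)
    (∨-least (transpose-⇨ (≤-trans (transpose-∧ ≤-refl) (minimum y))) y≤x⇨y)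
    where open ≤-Reasoning poset

-- Consequences of the identities of JIDL₁
module JIDL₁Facts (A : DQDAlgebra c ℓ) (A∈JIDL₁ : JIDL₁ A) where
  open DQDAlgebra A hiding (_≤_)
  open BoundedLatticeFacts A

  -- The valuation of the variables 0, 1, 2 used by the defining identities.
  assign : Carrier → Carrier → Carrier → ℕ → Carrier
  assign x y z 0 = x
  assign x y z 1 = y
  assign x y z _ = z

  x′∨[y⇒z]≈[x′∨y]⇒[x′∨z] : ∀ x y z → x ′ ∨ (y ⇒ z) ≈ (x ′ ∨ y ⇒ x ′ ∨ z)
  x′∨[y⇒z]≈[x′∨y]⇒[x′∨z] x y z = A∈JIDL₁ _ ′-∨-distrib-⇒ (assign x y z)

  ⇒-prelinear : ∀ x y → (x ⇒ y) ∨ (y ⇒ x) ≈ 1#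
  ⇒-prelinear x y = A∈JIDL₁ _ prelinear (assign x y y)

  -- With u = (x ∧ y ⇒ y) and w = (y ⇒ x ∧ y), prelinearity gives u ∨ w ≈ 1, and
  -- w ≤ u because relative to w the elements x ∧ y and y coincide.
  heyting : IsHeyting A
  heyting x y = begin-equality
    u           ≈⟨ ≤⇒∨≈ w≤u ⟨
    w ∨ u       ≈⟨ ∨-comm w u ⟩
    u ∨ w       ≈⟨ ⇒-prelinear (x ∧ y) y ⟩
    1#          ∎
    where
    open ≤-Reasoning poset
    u = x ∧ y ⇒ y
    w = y ⇒ x ∧ y

    w∧[x∧y]≈w∧y : w ∧ (x ∧ y) ≈ w ∧ y
    w∧[x∧y]≈w∧y = antisym (∧-monotonic ≤-refl (x∧y≤y x y)) $ ∧-greatest (x∧y≤x w y) $ begin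
      w ∧ y        ≈⟨ ∧-comm w y ⟩
      y ∧ w        ≈⟨ x∧[x⇒y]≈x∧y y (x ∧ y) ⟩
      y ∧ (x ∧ y)  ≤⟨ x∧y≤y _ _ ⟩
      x ∧ y        ∎

    w≤u : w ≤ u
    w≤u = begin
      w                            ≈⟨ ∧-identityʳ w ⟨
      w ∧ 1#                       ≈⟨ ∧-congˡ (x⇒x≈1 (w ∧ y)) ⟨
      w ∧ (w ∧ y ⇒ w ∧ y)          ≈⟨ ∧-congˡ (⇒-cong w∧[x∧y]≈w∧y ≈-refl) ⟨
      w ∧ (w ∧ (x ∧ y) ⇒ w ∧ y)    ≈⟨ x∧[y⇒z] w (x ∧ y) y ⟨
      w ∧ u                        ≤⟨ x∧y≤y w u ⟩
      u                            ∎

  open HeytingFacts A heyting public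

  x∧x′*≈[x∧x′*]′* : ∀ x → x ∧ x ′ * ≈ (x ∧ x ′ *) ′ *
  x∧x′*≈[x∧x′*]′* x = A∈JIDL₁ _ level-1 (assign x x x)

  -- The first identity at y = x ′ and z = 0.
  x′∨x′*≈1 : ∀ x → x ′ ∨ x ′ * ≈ 1#
  x′∨x′*≈1 x = begin-equality
    x ′ ∨ x ′ *               ≈⟨ x′∨[y⇒z]≈[x′∨y]⇒[x′∨z] x (x ′) 0# ⟩
    (x ′ ∨ x ′ ⇒ x ′ ∨ 0#)    ≈⟨ ⇒-cong (∨-idem _) (∨-identityʳ _) ⟩
    (x ′ ⇒ x ′)               ≈⟨ x⇒x≈1 _ ⟩
    1#                        ∎
    where open ≤-Reasoning poset

-- Central elements and the quotients they define
--
-- The complement of a central element is taken to be its image under ′: this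
-- is what makes the congruence determined by the element respect ′.
record IsCentral (A : DQDAlgebra c ℓ) (d : DQDAlgebra.Carrier A) : Set ℓ where
  open DQDAlgebra A
  field
    d∨d′≈1 : d ∨ d ′ ≈ 1#
    d∧d′≈0 : d ∧ d ′ ≈ 0#

module Centre (A : DQDAlgebra c ℓ) (heyting : IsHeyting A) where
  open DQDAlgebra A hiding (_≤_)
  open BoundedLatticeFacts A
  open HeytingFacts A heyting
  open IsCentral
  open ≤-Reasoning poset

  1-central : IsCentral A 1#
  1-central .d∨d′≈1 = ∨-zeroˡ _
  1-central .d∧d′≈0 = ≈-trans (∧-identityˡ _) 1′≈0

  ′-central : ∀ {d} → IsCentral A d → IsCentral A (d ′)
  ′-central {d} cd .d∨d′≈1 = begin-equality
    d ′ ∨ d ′ ′  ≈⟨ [x∧y]′≈x′∨y′ d (d ′) ⟨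
    (d ∧ d ′) ′  ≈⟨ ′-cong (d∧d′≈0 cd) ⟩
    0# ′         ≈⟨ 0′≈1 ⟩
    1#           ∎
  ′-central {d} cd .d∧d′≈0 = ≤0⇒≈0 $ begin
    d ′ ∧ d ′ ′  ≤⟨ ∧-monotonic ≤-refl (″-deflationary d) ⟩
    d ′ ∧ d      ≈⟨ ∧-comm _ _ ⟩
    d ∧ d ′      ≈⟨ d∧d′≈0 cd ⟩
    0#           ∎

  cover : ∀ {d} → IsCentral A d → ∀ x → x ≈ (d ∧ x) ∨ (d ′ ∧ x)
  cover {d} cd x = begin-equality
    x                      ≈⟨ ∧-identityˡ x ⟨
    1# ∧ x                 ≈⟨ ∧-congʳ (d∨d′≈1 cd) ⟨
    (d ∨ d ′) ∧ x          ≈⟨ ∧-distribʳ-∨ x d (d ′) ⟩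
    (d ∧ x) ∨ (d ′ ∧ x)    ∎

  ∧-central : ∀ {d e} → IsCentral A d → IsCentral A e → IsCentral A (d ∧ e)
  ∧-central {d} {e} cd ce .d∨d′≈1 = 1≤⇒≈1 $ begin
    1#                              ≈⟨ d∨d′≈1 ce ⟨
    e ∨ e ′                         ≈⟨ ∨-congʳ (cover cd e) ⟩
    ((d ∧ e) ∨ (d ′ ∧ e)) ∨ e ′     ≤⟨ ∨-least (∨-least (x≤x∨y _ _) (≤-trans (x∧y≤x _ _) (≤-trans (x≤x∨y _ _) (y≤x∨y _ _))))
                                              (≤-trans (y≤x∨y _ _) (y≤x∨y _ _)) ⟩
    (d ∧ e) ∨ (d ′ ∨ e ′)           ≈⟨ ∨-congˡ ([x∧y]′≈x′∨y′ d e) ⟨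
    (d ∧ e) ∨ (d ∧ e) ′             ∎
  ∧-central {d} {e} cd ce .d∧d′≈0 = ≤0⇒≈0 $ begin
    (d ∧ e) ∧ (d ∧ e) ′                    ≈⟨ ∧-congˡ ([x∧y]′≈x′∨y′ d e) ⟩
    (d ∧ e) ∧ (d ′ ∨ e ′)                  ≈⟨ ∧-distribˡ-∨ _ _ _ ⟩
    ((d ∧ e) ∧ d ′) ∨ ((d ∧ e) ∧ e ′)      ≤⟨ ∨-least (≤-trans (∧-monotonic (x∧y≤x d e) ≤-refl) (≤-reflexive (d∧d′≈0 cd)))
                                                     (≤-trans (∧-monotonic (x∧y≤y d e) ≤-refl) (≤-reflexive (d∧d′≈0 ce))) ⟩
    0#                                     ∎

  -- Equality modulo the filter generated by d.
  infix 4 _≈[_]_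
  _≈[_]_ : Carrier → Carrier → Carrier → Set ℓ
  x ≈[ d ] y = d ∧ x ≈ d ∧ y

  ≈⇒≈[] : ∀ {d x y} → x ≈ y → x ≈[ d ] y
  ≈⇒≈[] = ∧-congˡ

  ≈[]-weaken : ∀ {d e x y} → x ≈[ d ] y → x ≈[ d ∧ e ] y
  ≈[]-weaken {d} {e} {x} {y} x≈y = begin-equality
    (d ∧ e) ∧ x  ≈⟨ swap x ⟩
    e ∧ (d ∧ x)  ≈⟨ ∧-congˡ x≈y ⟩
    e ∧ (d ∧ y)  ≈⟨ swap y ⟨
    (d ∧ e) ∧ y  ∎
    where
    swap : ∀ z → (d ∧ e) ∧ z ≈ e ∧ (d ∧ z)
    swap z = ≈-trans (∧-congʳ (∧-comm d e)) (∧-assoc e d z)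

  ≈[]-weakenʳ : ∀ {d e x y} → x ≈[ e ] y → x ≈[ d ∧ e ] y
  ≈[]-weakenʳ x≈y = ≈-trans (∧-assoc _ _ _) (≈-trans (∧-congˡ x≈y) (≈-sym (∧-assoc _ _ _)))

  -- The quotients by a central element and by its complement separate points.
  ≈[]-glue : ∀ {d e x y} → IsCentral A e → x ≈[ d ∧ e ] y → x ≈[ d ∧ e ′ ] y → x ≈[ d ] y
  ≈[]-glue {d} {e} {x} {y} ce x≈y x≈′y = begin-equality
    d ∧ x                              ≈⟨ decompose x ⟩
    ((d ∧ e) ∧ x) ∨ ((d ∧ e ′) ∧ x)    ≈⟨ ∨-cong x≈y x≈′y ⟩
    ((d ∧ e) ∧ y) ∨ ((d ∧ e ′) ∧ y)    ≈⟨ decompose y ⟨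
    d ∧ y                              ∎
    where
    decompose : ∀ z → d ∧ z ≈ ((d ∧ e) ∧ z) ∨ ((d ∧ e ′) ∧ z)
    decompose z = begin-equality
      d ∧ z                              ≈⟨ ∧-congʳ (cover ce d) ⟩
      ((e ∧ d) ∨ (e ′ ∧ d)) ∧ z          ≈⟨ ∧-congʳ (∨-cong (∧-comm e d) (∧-comm (e ′) d)) ⟩
      ((d ∧ e) ∨ (d ∧ e ′)) ∧ z          ≈⟨ ∧-distribʳ-∨ z (d ∧ e) (d ∧ e ′) ⟩
      ((d ∧ e) ∧ z) ∨ ((d ∧ e ′) ∧ z)    ∎

  module _ (d : Carrier) where
    ∧-cong[] : ∀ {x y u v} → x ≈[ d ] y → u ≈[ d ] v → x ∧ u ≈[ d ] y ∧ v
    ∧-cong[] {x} {y} {u} {v} x≈y u≈v = begin-equality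
      d ∧ (x ∧ u)    ≈⟨ ∧-assoc d x u ⟨
      (d ∧ x) ∧ u    ≈⟨ ∧-congʳ x≈y ⟩
      (d ∧ y) ∧ u    ≈⟨ ∧-congʳ (∧-comm d y) ⟩
      (y ∧ d) ∧ u    ≈⟨ ∧-assoc y d u ⟩
      y ∧ (d ∧ u)    ≈⟨ ∧-congˡ u≈v ⟩
      y ∧ (d ∧ v)    ≈⟨ ∧-assoc y d v ⟨
      (y ∧ d) ∧ v    ≈⟨ ∧-congʳ (∧-comm y d) ⟩
      (d ∧ y) ∧ v    ≈⟨ ∧-assoc d y v ⟩
      d ∧ (y ∧ v)    ∎

    ∨-cong[] : ∀ {x y u v} → x ≈[ d ] y → u ≈[ d ] v → x ∨ u ≈[ d ] y ∨ v
    ∨-cong[] {x} {y} {u} {v} x≈y u≈v = begin-equality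
      d ∧ (x ∨ u)          ≈⟨ ∧-distribˡ-∨ d x u ⟩
      (d ∧ x) ∨ (d ∧ u)    ≈⟨ ∨-cong x≈y u≈v ⟩
      (d ∧ y) ∨ (d ∧ v)    ≈⟨ ∧-distribˡ-∨ d y v ⟨
      d ∧ (y ∨ v)          ∎

    ⇒-cong[] : ∀ {x y u v} → x ≈[ d ] y → u ≈[ d ] v → x ⇒ u ≈[ d ] y ⇒ v
    ⇒-cong[] {x} {y} {u} {v} x≈y u≈v = begin-equality
      d ∧ (x ⇒ u)            ≈⟨ x∧[y⇒z] d x u ⟩
      d ∧ (d ∧ x ⇒ d ∧ u)    ≈⟨ ∧-congˡ (⇒-cong x≈y u≈v) ⟩
      d ∧ (d ∧ y ⇒ d ∧ v)    ≈⟨ x∧[y⇒z] d y v ⟨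
      d ∧ (y ⇒ v)            ∎

    -- Centrality enters through d ∧ x ′ ≈ d ∧ (d ∧ x) ′, which holds since d ′ is
    -- disjoint from d.
    ′-cong[] : IsCentral A d → ∀ {x y} → x ≈[ d ] y → x ′ ≈[ d ] y ′
    ′-cong[] cd {x} {y} x≈y = begin-equality
      d ∧ x ′          ≈⟨ local x ⟩
      d ∧ (d ∧ x) ′    ≈⟨ ∧-congˡ (′-cong x≈y) ⟩
      d ∧ (d ∧ y) ′    ≈⟨ local y ⟨
      d ∧ y ′          ∎
      where
      local : ∀ z → d ∧ z ′ ≈ d ∧ (d ∧ z) ′
      local z = begin-equality
        d ∧ z ′                    ≈⟨ ∨-identityˡ _ ⟨
        0# ∨ (d ∧ z ′)             ≈⟨ ∨-congʳ (d∧d′≈0 cd) ⟨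
        (d ∧ d ′) ∨ (d ∧ z ′)      ≈⟨ ∧-distribˡ-∨ d (d ′) (z ′) ⟨
        d ∧ (d ′ ∨ z ′)            ≈⟨ ∧-congˡ ([x∧y]′≈x′∨y′ d z) ⟨
        d ∧ (d ∧ z) ′              ∎

  -- The quotient of A by the congruence of d. It keeps the carrier and the
  -- operations of A and only coarsens equality.
  infix 8 _/_
  _/_ : ∀ d → IsCentral A d → DQDAlgebra c ℓ
  d / cd = record
    { Carrier = Carrier
    ; _≈_ = _≈[ d ]_
    ; _∨_ = _∨_ ; _∧_ = _∧_ ; _⇒_ = _⇒_ ; _′ = _′ ; 0# = 0# ; 1# = 1#
    ; isDQDAlgebra = record
      { isSemiHeytingAlgebra = record
        { isLattice = record
          { isEquivalence = record { refl = ≈-refl ; sym = ≈-sym ; trans = ≈-trans }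
          ; ∨-comm     = λ x y → ≈⇒≈[] (∨-comm x y)
          ; ∨-assoc    = λ x y z → ≈⇒≈[] (∨-assoc x y z)
          ; ∨-cong     = ∨-cong[] d
          ; ∧-comm     = λ x y → ≈⇒≈[] (∧-comm x y)
          ; ∧-assoc    = λ x y z → ≈⇒≈[] (∧-assoc x y z)
          ; ∧-cong     = ∧-cong[] d
          ; absorptive = (λ x y → ≈⇒≈[] (∨-absorbs-∧ x y)) , (λ x y → ≈⇒≈[] (∧-absorbs-∨ x y))
          }
        ; ∨-identityʳ = λ x → ≈⇒≈[] (∨-identityʳ x)
        ; ∧-identityʳ = λ x → ≈⇒≈[] (∧-identityʳ x)
        ; ⇒-cong      = ⇒-cong[] d
        ; x∧[x⇒y]≈x∧y = λ x y → ≈⇒≈[] (x∧[x⇒y]≈x∧y x y)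
        ; x∧[y⇒z]     = λ x y z → ≈⇒≈[] (x∧[y⇒z] x y z)
        ; x⇒x≈1       = λ x → ≈⇒≈[] (x⇒x≈1 x)
        }
      ; ′-cong       = ′-cong[] d cd
      ; 0′≈1         = ≈⇒≈[] 0′≈1
      ; 1′≈0         = ≈⇒≈[] 1′≈0
      ; [x∧y]′≈x′∨y′ = λ x y → ≈⇒≈[] ([x∧y]′≈x′∨y′ x y)
      ; [x∨y]″≈x″∨y″ = λ x y → ≈⇒≈[] ([x∨y]″≈x″∨y″ x y)
      ; x″≤x         = λ x → ≈⇒≈[] (x″≤x x)
      }
    }

-- Splitting into trichotomous pieces

module _ (A : DQDAlgebra c ℓ) where
  open DQDAlgebra A

  Fixed : Carrier → Set ℓ
  Fixed x = x ≈ x ′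

  -- In a dually Stone Heyting chain every element is extremal.
  Extremal : Carrier → Set ℓ
  Extremal x = x ≈ 1# ⊎ x ′ ≈ 1#

  Trichotomous : Carrier → Set ℓ
  Trichotomous x = Fixed x ⊎ Extremal x

module Localisation (A : DQDAlgebra c ℓ) (A∈JIDL₁ : JIDL₁ A) where
  open DQDAlgebra A hiding (_≤_)
  open BoundedLatticeFacts A
  open JIDL₁Facts A A∈JIDL₁
  open Centre A heyting public
  open IsCentral
  open ≤-Reasoning poset

  /-JIDL₁ : ∀ {d} (cd : IsCentral A d) → JIDL₁ (d / cd)
  /-JIDL₁ cd _ ′-∨-distrib-⇒ ρ = ≈⇒≈[] (A∈JIDL₁ _ ′-∨-distrib-⇒ ρ)
  /-JIDL₁ cd _ prelinear     ρ = ≈⇒≈[] (A∈JIDL₁ _ prelinear ρ)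
  /-JIDL₁ cd _ level-1       ρ = ≈⇒≈[] (A∈JIDL₁ _ level-1 ρ)

  -- If p = x ∧ x ′ *, the level-1 identity reads p ≈ p ′ *, and p ′ * is a
  -- complement of p ′.
  x∧x′*-central : ∀ x → IsCentral A (x ∧ x ′ *)
  x∧x′*-central x .d∨d′≈1 = begin-equality
    p ∨ p ′      ≈⟨ ∨-congʳ (x∧x′*≈[x∧x′*]′* x) ⟩
    p ′ * ∨ p ′  ≈⟨ ∨-comm _ _ ⟩
    p ′ ∨ p ′ *  ≈⟨ x′∨x′*≈1 p ⟩
    1#           ∎
    where p = x ∧ x ′ *
  x∧x′*-central x .d∧d′≈0 = begin-equality
    p ∧ p ′      ≈⟨ ∧-congʳ (x∧x′*≈[x∧x′*]′* x) ⟩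
    p ′ * ∧ p ′  ≈⟨ ∧-comm _ _ ⟩
    p ′ ∧ p ′ *  ≈⟨ x∧x*≈0 _ ⟩
    0#           ∎
    where p = x ∧ x ′ *

  x≈[x∧x′*]1 : ∀ x → x ≈[ x ∧ x ′ * ] 1#
  x≈[x∧x′*]1 x = antisym (∧-greatest (x∧y≤x _ _) (maximum _)) (∧-greatest (x∧y≤x _ _) (≤-trans (x∧y≤x _ _) (x∧y≤x _ _)))

  d∧x≤x′ : ∀ x {d} → d ≤ (x ∧ x ′ *) ′ → d ∧ x ≤ x ′
  d∧x≤x′ x {d} d≤p′ = x≤y∨z⇒x≤y
    (≤-trans (maximum _) (≤-reflexive (≈-sym (x′∨x′*≈1 x))))
    (≤0⇒≈0 (begin
      (d ∧ x) ∧ x ′ *    ≈⟨ ∧-assoc _ _ _ ⟩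
      d ∧ p              ≤⟨ ∧-monotonic d≤p′ ≤-refl ⟩
      p ′ ∧ p            ≈⟨ ∧-comm _ _ ⟩
      p ∧ p ′            ≈⟨ d∧d′≈0 (x∧x′*-central x) ⟩
      0#                 ∎))
    where p = x ∧ x ′ *

  -- To prove an equation modulo d it suffices to prove it modulo every central e
  -- whose congruence contains that of d and for which x is trichotomous.
  locally-trichotomous : ∀ x {d u v} → IsCentral A d →
    (∀ {e} (ce : IsCentral A e) → (∀ {y z} → y ≈[ d ] z → y ≈[ e ] z) →
      Trichotomous (e / ce) x → u ≈[ e ] v) →
    u ≈[ d ] v
  locally-trichotomous x {d} cd k =
    ≈[]-glue cp
      (k (∧-central cd cp) ≈[]-weaken (inj₂ (inj₁ (≈[]-weakenʳ (x≈[x∧x′*]1 x)))))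
      (≈[]-glue cq
        (k (∧-central cdp′ cq) (≈[]-weaken ∘ ≈[]-weaken) (inj₂ (inj₂ (≈[]-weakenʳ (x≈[x∧x′*]1 (x ′))))))
        (k (∧-central cdp′ (′-central cq)) (≈[]-weaken ∘ ≈[]-weaken) (inj₁ fixed)))
    where
    cp   = x∧x′*-central x
    cq   = x∧x′*-central (x ′)
    cdp′ = ∧-central cd (′-central cp)

    -- Modulo the complement of p = x ∧ x ′ * one has x ≤ x ′; modulo that of
    -- q = x ′ ∧ x ′ ′ * one has x ′ ≤ x ′ ′, and x ′ ′ ≤ x always.
    fixed : x ≈[ (d ∧ (x ∧ x ′ *) ′) ∧ (x ′ ∧ x ′ ′ *) ′ ] x ′
    fixed = antisym
      (∧-greatest (x∧y≤x _ _) (d∧x≤x′ x (≤-trans (x∧y≤x _ _) (x∧y≤y _ _))))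
      (∧-greatest (x∧y≤x _ _) (≤-trans (d∧x≤x′ (x ′) (x∧y≤y _ _)) (″-deflationary x)))

  locally-all-trichotomous : ∀ xs {d u v} → IsCentral A d →
    (∀ {e} (ce : IsCentral A e) → All (Trichotomous (e / ce)) xs → u ≈[ e ] v) → u ≈[ d ] v
  locally-all-trichotomous []       cd k = k cd []
  locally-all-trichotomous (x ∷ xs) cd k =
    locally-all-trichotomous xs cd λ ce tris →
    locally-trichotomous x ce λ cf weaken tri →
    k cf (tri ∷ All.map (Sum.map weaken (Sum.map weaken weaken)) tris)

  ≈[1]⇒≈ : ∀ {x y} → x ≈[ 1# ] y → x ≈ y
  ≈[1]⇒≈ x≈y = ≈-trans (≈-sym (∧-identityˡ _)) (≈-trans x≈y (∧-identityˡ _))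

-- Homomorphisms and transfer of identities
record IsHomomorphism {b ℓᵇ} (B : DQDAlgebra b ℓᵇ) (A : DQDAlgebra c ℓ)
                      (h : DQDAlgebra.Carrier B → DQDAlgebra.Carrier A) : Set (b ⊔ ℓᵇ ⊔ ℓ) where
  private
    module B = DQDAlgebra B
  open DQDAlgebra A
  field
    h-cong : ∀ {x y} → x B.≈ y → h x ≈ h y
    ∨-homo : ∀ x y → h (x B.∨ y) ≈ h x ∨ h y
    ∧-homo : ∀ x y → h (x B.∧ y) ≈ h x ∧ h y
    ⇒-homo : ∀ x y → h (x B.⇒ y) ≈ h x ⇒ h y
    ′-homo : ∀ x → h (x B.′) ≈ h x ′
    0-homo : h B.0# ≈ 0#
    1-homo : h B.1# ≈ 1#

vars : Term → List ℕ
vars (var n)  = [ n ]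
vars (s ∨ₜ t) = vars s ++ vars t
vars (s ∧ₜ t) = vars s ++ vars t
vars (s ⇒ₜ t) = vars s ++ vars t
vars (t ′ₜ)   = vars t
vars 0ₜ       = []
vars 1ₜ       = []

module Homomorphism {b ℓᵇ} {B : DQDAlgebra b ℓᵇ} {A : DQDAlgebra c ℓ}
                    {h : DQDAlgebra.Carrier B → DQDAlgebra.Carrier A} (hom : IsHomomorphism B A h) where
  private
    module B = DQDAlgebra B
  open DQDAlgebra A
  open IsHomomorphism hom

  -- Valuations need only agree on the variables of the term.
  ⟦⟧-homo : ∀ t {ν ρ} → (∀ {n} → n ∈ vars t → h (ν n) ≈ ρ n) → h (⟦_⟧ B t ν) ≈ ⟦_⟧ A t ρ
  ⟦⟧-homo (var n)  hν≈ρ = hν≈ρ (here refl)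
  ⟦⟧-homo (s ∨ₜ t) hν≈ρ = ≈-trans (∨-homo _ _) (∨-cong (⟦⟧-homo s (hν≈ρ ∘ ∈-++⁺ˡ)) (⟦⟧-homo t (hν≈ρ ∘ ∈-++⁺ʳ (vars s))))
  ⟦⟧-homo (s ∧ₜ t) hν≈ρ = ≈-trans (∧-homo _ _) (∧-cong (⟦⟧-homo s (hν≈ρ ∘ ∈-++⁺ˡ)) (⟦⟧-homo t (hν≈ρ ∘ ∈-++⁺ʳ (vars s))))
  ⟦⟧-homo (s ⇒ₜ t) hν≈ρ = ≈-trans (⇒-homo _ _) (⇒-cong (⟦⟧-homo s (hν≈ρ ∘ ∈-++⁺ˡ)) (⟦⟧-homo t (hν≈ρ ∘ ∈-++⁺ʳ (vars s))))
  ⟦⟧-homo (t ′ₜ)   hν≈ρ = ≈-trans (′-homo _) (′-cong (⟦⟧-homo t hν≈ρ))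
  ⟦⟧-homo 0ₜ       hν≈ρ = 0-homo
  ⟦⟧-homo 1ₜ       hν≈ρ = 1-homo

  -- An identity of B holds in A at ρ as soon as the values of its variables have
  -- preimages under a homomorphism from B to A.
  transfer : ∀ {s t ρ} → B ⊨ (s ≈ₜ t) →
             (∀ {n} → n ∈ vars s ++ vars t → ∃[ x ] h x ≈ ρ n) →
             ⟦_⟧ A s ρ ≈ ⟦_⟧ A t ρ
  transfer {s} {t} {ρ} B⊨s≈t preimage =
    ≈-trans (≈-sym (⟦⟧-homo s (hν≈ρ ∘ ∈-++⁺ˡ)))
      (≈-trans (h-cong (B⊨s≈t ν)) (⟦⟧-homo t (hν≈ρ ∘ ∈-++⁺ʳ (vars s))))
    where
    -- Variables not occurring in the identity are sent to an arbitrary element.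
    ν : ℕ → B.Carrier
    ν n with n ∈? vars s ++ vars t
    ... | yes n∈ = proj₁ (preimage n∈)
    ... | no  _  = B.0#

    hν≈ρ : ∀ {n} → n ∈ vars s ++ vars t → h (ν n) ≈ ρ n
    hν≈ρ {n} n∈ with n ∈? vars s ++ vars t
    ... | yes n∈′ = proj₂ (preimage n∈′)
    ... | no  n∉  = contradiction n∈ n∉

-- Subsets closed up to equality

module _ (A : DQDAlgebra c ℓ) (P : Pred (DQDAlgebra.Carrier A) c) where
  open DQDAlgebra A

  -- P is not required to respect ≈, so membership of u is replaced by the
  -- existence of an element of P equal to u.
  Represented : Carrier → Set (c ⊔ ℓ)
  Represented u = ∃[ x ] P x × x ≈ u

  -- P contains 0 and 1 and is closed under the operations, up to ≈.
  record IsSubuniverse : Set (c ⊔ ℓ) where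
    field
      0-closed : Represented 0#
      1-closed : Represented 1#
      ∨-closed : ∀ {x y} → P x → P y → Represented (x ∨ y)
      ∧-closed : ∀ {x y} → P x → P y → Represented (x ∧ y)
      ⇒-closed : ∀ {x y} → P x → P y → Represented (x ⇒ y)
      ′-closed : ∀ {x} → P x → Represented (x ′)

-- The subalgebra on P. Its operations choose representatives, and each law is
-- inherited by computing what both sides represent in A.
module Subalgebra (A : DQDAlgebra c ℓ) (P : Pred (DQDAlgebra.Carrier A) c)
                  (P-closed : IsSubuniverse A P) where
  private
    module A = DQDAlgebra A
  open A using (_≈_; ≈-refl; ≈-sym; ≈-trans)
  open IsSubuniverse P-closed

  Carrier : Set c
  Carrier = ∃[ x ] P x

  representative : ∀ {u} → Represented A P u → Carrier
  representative (x , x∈P , _) = x , x∈P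

  infix 4 _↝_
  -- The element x of the subalgebra represents the element u of A.
  record _↝_ (x : Carrier) (u : A.Carrier) : Set ℓ where
    constructor represents
    field
      value : proj₁ x ≈ u
  open _↝_

  _∨_ _∧_ _⇒_ : Carrier → Carrier → Carrier
  (_ , x∈P) ∨ (_ , y∈P) = representative (∨-closed x∈P y∈P)
  (_ , x∈P) ∧ (_ , y∈P) = representative (∧-closed x∈P y∈P)
  (_ , x∈P) ⇒ (_ , y∈P) = representative (⇒-closed x∈P y∈P)

  _′ : Carrier → Carrier
  (_ , x∈P) ′ = representative (′-closed x∈P)

  0# 1# : Carrier
  0# = representative 0-closed
  1# = representative 1-closed

  infixr 7 _∧↝_
  infixr 6 _∨↝_
  infixr 5 _⇒↝_
  infixl 9 _′↝

  _∨↝_ : ∀ {x y u v} → x ↝ u → y ↝ v → x ∨ y ↝ u A.∨ v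
  _∨↝_ {_ , x∈P} {_ , y∈P} p q = represents (≈-trans (proj₂ (proj₂ (∨-closed x∈P y∈P))) (A.∨-cong (value p) (value q)))

  _∧↝_ : ∀ {x y u v} → x ↝ u → y ↝ v → x ∧ y ↝ u A.∧ v
  _∧↝_ {_ , x∈P} {_ , y∈P} p q = represents (≈-trans (proj₂ (proj₂ (∧-closed x∈P y∈P))) (A.∧-cong (value p) (value q)))

  _⇒↝_ : ∀ {x y u v} → x ↝ u → y ↝ v → x ⇒ y ↝ (u A.⇒ v)
  _⇒↝_ {_ , x∈P} {_ , y∈P} p q = represents (≈-trans (proj₂ (proj₂ (⇒-closed x∈P y∈P))) (A.⇒-cong (value p) (value q)))

  _′↝ : ∀ {x u} → x ↝ u → x ′ ↝ (u A.′)
  _′↝ {_ , x∈P} p = represents (≈-trans (proj₂ (proj₂ (′-closed x∈P))) (A.′-cong (value p)))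

  0↝ : 0# ↝ A.0#
  0↝ = represents (proj₂ (proj₂ 0-closed))

  1↝ : 1# ↝ A.1#
  1↝ = represents (proj₂ (proj₂ 1-closed))

  ⟨_⟩ : ∀ x → x ↝ proj₁ x
  ⟨ _ ⟩ = represents ≈-refl

  law : ∀ {x y u v} → x ↝ u → u ≈ v → y ↝ v → proj₁ x ≈ proj₁ y
  law x↝u u≈v y↝v = ≈-trans (value x↝u) (≈-trans u≈v (≈-sym (value y↝v)))

  subalgebra : DQDAlgebra c ℓ
  subalgebra = record
    { Carrier = Carrier
    ; _≈_ = λ x y → proj₁ x ≈ proj₁ y
    ; _∨_ = _∨_ ; _∧_ = _∧_ ; _⇒_ = _⇒_ ; _′ = _′ ; 0# = 0# ; 1# = 1#
    ; isDQDAlgebra = record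
      { isSemiHeytingAlgebra = record
        { isLattice = record
          { isEquivalence = record { refl = ≈-refl ; sym = ≈-sym ; trans = ≈-trans }
          ; ∨-comm     = λ x y → law (⟨ x ⟩ ∨↝ ⟨ y ⟩) (A.∨-comm _ _) (⟨ y ⟩ ∨↝ ⟨ x ⟩)
          ; ∨-assoc    = λ x y z → law ((⟨ x ⟩ ∨↝ ⟨ y ⟩) ∨↝ ⟨ z ⟩) (A.∨-assoc _ _ _) (⟨ x ⟩ ∨↝ ⟨ y ⟩ ∨↝ ⟨ z ⟩)
          ; ∨-cong     = λ {x} {y} {u} {v} x≈y u≈v → law (⟨ x ⟩ ∨↝ ⟨ u ⟩) (A.∨-cong x≈y u≈v) (⟨ y ⟩ ∨↝ ⟨ v ⟩)
          ; ∧-comm     = λ x y → law (⟨ x ⟩ ∧↝ ⟨ y ⟩) (A.∧-comm _ _) (⟨ y ⟩ ∧↝ ⟨ x ⟩)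
          ; ∧-assoc    = λ x y z → law ((⟨ x ⟩ ∧↝ ⟨ y ⟩) ∧↝ ⟨ z ⟩) (A.∧-assoc _ _ _) (⟨ x ⟩ ∧↝ ⟨ y ⟩ ∧↝ ⟨ z ⟩)
          ; ∧-cong     = λ {x} {y} {u} {v} x≈y u≈v → law (⟨ x ⟩ ∧↝ ⟨ u ⟩) (A.∧-cong x≈y u≈v) (⟨ y ⟩ ∧↝ ⟨ v ⟩)
          ; absorptive = (λ x y → law (⟨ x ⟩ ∨↝ ⟨ x ⟩ ∧↝ ⟨ y ⟩) (A.∨-absorbs-∧ _ _) ⟨ x ⟩)
                       , (λ x y → law (⟨ x ⟩ ∧↝ (⟨ x ⟩ ∨↝ ⟨ y ⟩)) (A.∧-absorbs-∨ _ _) ⟨ x ⟩)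
          }
        ; ∨-identityʳ = λ x → law (⟨ x ⟩ ∨↝ 0↝) (A.∨-identityʳ _) ⟨ x ⟩
        ; ∧-identityʳ = λ x → law (⟨ x ⟩ ∧↝ 1↝) (A.∧-identityʳ _) ⟨ x ⟩
        ; ⇒-cong      = λ {x} {y} {u} {v} x≈y u≈v → law (⟨ x ⟩ ⇒↝ ⟨ u ⟩) (A.⇒-cong x≈y u≈v) (⟨ y ⟩ ⇒↝ ⟨ v ⟩)
        ; x∧[x⇒y]≈x∧y = λ x y → law (⟨ x ⟩ ∧↝ (⟨ x ⟩ ⇒↝ ⟨ y ⟩)) (A.x∧[x⇒y]≈x∧y _ _) (⟨ x ⟩ ∧↝ ⟨ y ⟩)
        ; x∧[y⇒z]     = λ x y z → law (⟨ x ⟩ ∧↝ (⟨ y ⟩ ⇒↝ ⟨ z ⟩)) (A.x∧[y⇒z] _ _ _)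
                                      (⟨ x ⟩ ∧↝ (⟨ x ⟩ ∧↝ ⟨ y ⟩ ⇒↝ ⟨ x ⟩ ∧↝ ⟨ z ⟩))
        ; x⇒x≈1       = λ x → law (⟨ x ⟩ ⇒↝ ⟨ x ⟩) (A.x⇒x≈1 _) 1↝
        }
      ; ′-cong       = λ {x} {y} x≈y → law (⟨ x ⟩ ′↝) (A.′-cong x≈y) (⟨ y ⟩ ′↝)
      ; 0′≈1         = law (0↝ ′↝) A.0′≈1 1↝
      ; 1′≈0         = law (1↝ ′↝) A.1′≈0 0↝
      ; [x∧y]′≈x′∨y′ = λ x y → law ((⟨ x ⟩ ∧↝ ⟨ y ⟩) ′↝) (A.[x∧y]′≈x′∨y′ _ _) (⟨ x ⟩ ′↝ ∨↝ ⟨ y ⟩ ′↝)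
      ; [x∨y]″≈x″∨y″ = λ x y → law ((⟨ x ⟩ ∨↝ ⟨ y ⟩) ′↝ ′↝) (A.[x∨y]″≈x″∨y″ _ _) (⟨ x ⟩ ′↝ ′↝ ∨↝ ⟨ y ⟩ ′↝ ′↝)
      ; x″≤x         = λ x → law (⟨ x ⟩ ′↝ ′↝ ∧↝ ⟨ x ⟩) (A.x″≤x _) (⟨ x ⟩ ′↝ ′↝)
      }
    }

  inclusion : IsHomomorphism subalgebra A proj₁
  inclusion = record
    { h-cong = id
    ; ∨-homo = λ x y → value (⟨ x ⟩ ∨↝ ⟨ y ⟩)
    ; ∧-homo = λ x y → value (⟨ x ⟩ ∧↝ ⟨ y ⟩)
    ; ⇒-homo = λ x y → value (⟨ x ⟩ ⇒↝ ⟨ y ⟩)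
    ; ′-homo = λ x → value (⟨ x ⟩ ′↝)
    ; 0-homo = value 0↝
    ; 1-homo = value 1↝
    }

-- The chain case
--
-- G is a set of generators all of whose elements and implications are
-- extremal; it then carries a dually Stone Heyting chain.
module ExtremalCase (B : DQDAlgebra c ℓ) (B∈JIDL₁ : JIDL₁ B)
                    (G : Pred (DQDAlgebra.Carrier B) c)
                    (0∈G : G (DQDAlgebra.0# B)) (1∈G : G (DQDAlgebra.1# B))
                    (G-extremal : ∀ {x} → G x → Extremal B x)
                    (⇒-extremal : ∀ {x y} → G x → G y → Extremal B (DQDAlgebra._⇒_ B x y)) where
  open DQDAlgebra B hiding (_≤_)
  open BoundedLatticeFacts B
  open JIDL₁Facts B B∈JIDL₁
  open ≤-Reasoning poset

  -- Put i = (x ⇒ y). If i ≈ 1 then x ≤ y. Otherwise i ′ ≈ 1, so i is negligible in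
  -- the two instances of prelinearity in which it occurs as a joinand:
  -- (y ⇒ x) ∨ i ≈ 1 gives y ≤ x, and (i ⇒ x) ∨ (x ⇒ i) ≈ 1, where x ⇒ i ≈ i, gives
  -- i ≤ x, whence i ≤ y.
  compare : ∀ {x y} → G x → G y → x ≤ y ⊎ (y ≤ x × (x ⇒ y) ≈ y)
  compare {x} {y} x∈G y∈G with ⇒-extremal x∈G y∈G
  ... | inj₁ i≈1  = inj₁ (⇒≈1⇒≤ i≈1)
  ... | inj₂ i′≈1 = inj₂ (⇒≈1⇒≤ (x∨y≈1⇒x≈1 i′≈1 (⇒-prelinear y x)) , antisym i≤y y≤x⇨y)
    where
    i = x ⇒ y

    x⇒i≈i : x ⇒ i ≈ i
    x⇒i≈i = antisym
      (transpose-⇨ (≤-trans (∧-greatest (transpose-∧ ≤-refl) (x∧y≤y _ _)) (transpose-∧ ≤-refl)))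
      y≤x⇨y

    i≤x : i ≤ x
    i≤x = ⇒≈1⇒≤ (x∨y≈1⇒x≈1 (≈-trans (′-cong x⇒i≈i) i′≈1) (⇒-prelinear i x))

    i≤y : i ≤ y
    i≤y = ≤-trans (∧-greatest ≤-refl i≤x) (transpose-∧ ≤-refl)

  G-closed : IsSubuniverse B G
  G-closed = record
    { 0-closed = _ , 0∈G , ≈-refl
    ; 1-closed = _ , 1∈G , ≈-refl
    ; ∨-closed = ∨-closed
    ; ∧-closed = ∧-closed
    ; ⇒-closed = ⇒-closed
    ; ′-closed = ′-closed
    }
    where
    ∨-closed : ∀ {x y} → G x → G y → Represented B G (x ∨ y)
    ∨-closed x∈G y∈G with compare x∈G y∈G
    ... | inj₁ x≤y       = _ , y∈G , ≈-sym (≤⇒∨≈ x≤y)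
    ... | inj₂ (y≤x , _) = _ , x∈G , ≈-sym (≈-trans (∨-comm _ _) (≤⇒∨≈ y≤x))

    ∧-closed : ∀ {x y} → G x → G y → Represented B G (x ∧ y)
    ∧-closed x∈G y∈G with compare x∈G y∈G
    ... | inj₁ x≤y       = _ , x∈G , x≤y
    ... | inj₂ (y≤x , _) = _ , y∈G , ≈-trans y≤x (∧-comm _ _)

    ⇒-closed : ∀ {x y} → G x → G y → Represented B G (x ⇒ y)
    ⇒-closed x∈G y∈G with compare x∈G y∈G
    ... | inj₁ x≤y         = _ , 1∈G , ≈-sym (≤⇒⇒≈1 x≤y)
    ... | inj₂ (_ , x⇒y≈y) = _ , y∈G , ≈-sym x⇒y≈y

    ′-closed : ∀ {x} → G x → Represented B G (x ′)
    ′-closed x∈G with G-extremal x∈G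
    ... | inj₁ x≈1  = _ , 0∈G , ≈-sym (≈-trans (′-cong x≈1) 1′≈0)
    ... | inj₂ x′≈1 = _ , 1∈G , ≈-sym x′≈1

  open Subalgebra B G G-closed using (subalgebra; inclusion; law; ⟨_⟩; _∧↝_; _⇒↝_; _′↝; 0↝; 1↝)

  isDuallyStoneHeytingChain : IsDuallyStoneHeytingChain subalgebra
  isDuallyStoneHeytingChain = record
    { duallyStone = λ x → law (⟨ x ⟩ ′↝ ∧↝ ⟨ x ⟩ ′↝ ′↝) (duallyStone (G-extremal (proj₂ x))) 0↝
    ; heyting     = λ x y → law (⟨ x ⟩ ∧↝ ⟨ y ⟩ ⇒↝ ⟨ y ⟩) (heyting _ _) 1↝
    ; chain       = λ x y → Sum.map
        (λ x≤y → law (⟨ x ⟩ ∧↝ ⟨ y ⟩) (≈-sym x≤y) ⟨ x ⟩)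
        (λ (y≤x , _) → law (⟨ y ⟩ ∧↝ ⟨ x ⟩) (≈-sym y≤x) ⟨ y ⟩)
        (compare (proj₂ x) (proj₂ y))
    }
    where
    duallyStone : ∀ {x} → Extremal B x → x ′ ∧ x ′ ′ ≈ 0#
    duallyStone (inj₁ x≈1)  = ≈-trans (∧-congʳ (≈-trans (′-cong x≈1) 1′≈0)) (∧-zeroˡ _)
    duallyStone (inj₂ x′≈1) = ≈-trans (∧-congˡ (x′≈1⇒x″≈0 x′≈1)) (∧-zeroʳ _)

  chain⊨⇒⟦⟧≈ : ∀ {s t ρ} → (∀ {C : DQDAlgebra c ℓ} → IsDuallyStoneHeytingChain C → C ⊨ (s ≈ₜ t)) →
               (∀ {n} → n ∈ vars s ++ vars t → G (ρ n)) →
               ⟦_⟧ B s ρ ≈ ⟦_⟧ B t ρ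
  chain⊨⇒⟦⟧≈ {s} {t} chains⊨ ρ∈G =
    Homomorphism.transfer inclusion {s} {t} (chains⊨ isDuallyStoneHeytingChain) λ n∈ → (_ , ρ∈G n∈) , ≈-refl

-- The four-element case
module FixedCase (B : DQDAlgebra c ℓ) (B∈JIDL₁ : JIDL₁ B) where
  open DQDAlgebra B hiding (_≤_)
  open BoundedLatticeFacts B
  open JIDL₁Facts B B∈JIDL₁
  open ≤-Reasoning poset

  fixed⇒x″≈x : ∀ {a} → Fixed B a → a ′ ′ ≈ a
  fixed⇒x″≈x a≈a′ = ≈-trans (′-cong (≈-sym a≈a′)) (≈-sym a≈a′)

  1≈0⇒≈ : 1# ≈ 0# → ∀ {x y} → x ≈ y
  1≈0⇒≈ 1≈0 = ≈-trans (≈0 _) (≈-sym (≈0 _))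
    where
    ≈0 : ∀ x → x ≈ 0#
    ≈0 x = ≤0⇒≈0 (≤-trans (maximum x) (≤-reflexive 1≈0))

  -- A fixed point equal to 1 or to 0 collapses the algebra.
  fixed1⇒≈ : ∀ {a} → Fixed B a → a ≈ 1# → ∀ {x y} → x ≈ y
  fixed1⇒≈ a≈a′ a≈1 = 1≈0⇒≈ (≈-trans (≈-sym a≈1) (≈-trans a≈a′ (≈-trans (′-cong a≈1) 1′≈0)))

  fixed0⇒≈ : ∀ {a} → Fixed B a → a ≈ 0# → ∀ {x y} → x ≈ y
  fixed0⇒≈ a≈a′ a≈0 = 1≈0⇒≈ (≈-sym (≈-trans (≈-sym a≈0) (≈-trans a≈a′ (≈-trans (′-cong a≈0) 0′≈1))))

  -- Let w = x ∨ a. Then w ′ ′ ≈ a; if w is fixed then w ≈ a, and the other two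
  -- possibilities for w collapse the algebra.
  x′≈1⇒x≤fixed : ∀ {x a} → Fixed B a → x ′ ≈ 1# → Trichotomous B (x ∨ a) → x ≤ a
  x′≈1⇒x≤fixed {x} {a} a≈a′ x′≈1 = λ
    { (inj₁ w≈w′)        → ≤-trans (x≤x∨y x a) (≤-reflexive (≈-trans w≈w′ (≈-trans (′-cong w≈w′) w″≈a)))
    ; (inj₂ (inj₁ w≈1))  → ≤-reflexive (fixed1⇒≈ a≈a′ (≈-trans (≈-sym w″≈a) (≈-trans (′-cong (′-cong w≈1)) 1″≈1)))
    ; (inj₂ (inj₂ w′≈1)) → ≤-reflexive (fixed0⇒≈ a≈a′ (≈-trans (≈-sym w″≈a) (x′≈1⇒x″≈0 w′≈1)))
    }
    where
    w″≈a : (x ∨ a) ′ ′ ≈ a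
    w″≈a = begin-equality
      (x ∨ a) ′ ′    ≈⟨ [x∨y]″≈x″∨y″ x a ⟩
      x ′ ′ ∨ a ′ ′  ≈⟨ ∨-cong (x′≈1⇒x″≈0 x′≈1) (fixed⇒x″≈x a≈a′) ⟩
      0# ∨ a         ≈⟨ ∨-identityˡ a ⟩
      a              ∎

  fixed∨*≈1 : ∀ {a} → Fixed B a → a ∨ a * ≈ 1#
  fixed∨*≈1 {a} a≈a′ = ≈-trans (∨-cong a≈a′ (⇒-cong a≈a′ ≈-refl)) (x′∨x′*≈1 a)

  *-fixed : ∀ {a} → Fixed B a → Trichotomous B (a *) → Fixed B (a *)
  *-fixed _ (inj₁ fixed) = fixed
  *-fixed {a} a≈a′ (inj₂ (inj₁ a*≈1)) =
    fixed0⇒≈ a≈a′ (≈-trans (≈-sym (∧-identityʳ a)) (≈-trans (∧-congˡ (≈-sym a*≈1)) (x∧x*≈0 a)))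
  *-fixed a≈a′ (inj₂ (inj₂ a*′≈1)) = fixed1⇒≈ a≈a′ (x∨y≈1⇒x≈1 a*′≈1 (fixed∨*≈1 a≈a′))

  module _ {a : Carrier} (a-fixed : Fixed B a) (a*-fixed : Fixed B (a *)) where

    a∨a*≈1 : a ∨ a * ≈ 1#
    a∨a*≈1 = fixed∨*≈1 a-fixed

    a**≈a : a * * ≈ a
    a**≈a = complement-unique (≈-trans (∨-comm _ _) a∨a*≈1) (≈-trans (∧-comm _ _) (x∧x*≈0 a))

    open Four using (𝟘; 𝟙; complement) renaming (a to 𝕒; b to 𝕓)

    -- The image of D₂ generated by the fixed point a; the other atom goes to a *.
    h : Four.Carrier → Carrier
    h 𝟘 = 0#
    h 𝕒 = a
    h 𝕓 = a *
    h 𝟙 = 1#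

    h-∨ : ∀ x y → h (x Four.∨ y) ≈ h x ∨ h y
    h-∨ 𝟘 y = ≈-sym (∨-identityˡ (h y))
    h-∨ 𝟙 y = ≈-sym (∨-zeroˡ (h y))
    h-∨ x@𝕒 𝟘 = ≈-sym (∨-identityʳ (h x))
    h-∨ 𝕒 𝕒 = ≈-sym (∨-idem _)
    h-∨ 𝕒 𝕓 = ≈-sym a∨a*≈1
    h-∨ x@𝕒 𝟙 = ≈-sym (∨-zeroʳ (h x))
    h-∨ x@𝕓 𝟘 = ≈-sym (∨-identityʳ (h x))
    h-∨ 𝕓 𝕒 = ≈-sym (≈-trans (∨-comm _ _) a∨a*≈1)
    h-∨ 𝕓 𝕓 = ≈-sym (∨-idem _)
    h-∨ x@𝕓 𝟙 = ≈-sym (∨-zeroʳ (h x))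

    h-∧ : ∀ x y → h (x Four.∧ y) ≈ h x ∧ h y
    h-∧ 𝟘 y = ≈-sym (∧-zeroˡ (h y))
    h-∧ 𝟙 y = ≈-sym (∧-identityˡ (h y))
    h-∧ x@𝕒 𝟘 = ≈-sym (∧-zeroʳ (h x))
    h-∧ 𝕒 𝕒 = ≈-sym (∧-idem _)
    h-∧ 𝕒 𝕓 = ≈-sym (x∧x*≈0 a)
    h-∧ x@𝕒 𝟙 = ≈-sym (∧-identityʳ (h x))
    h-∧ x@𝕓 𝟘 = ≈-sym (∧-zeroʳ (h x))
    h-∧ 𝕓 𝕒 = ≈-sym (≈-trans (∧-comm _ _) (x∧x*≈0 a))
    h-∧ 𝕓 𝕓 = ≈-sym (∧-idem _)
    h-∧ x@𝕓 𝟙 = ≈-sym (∧-identityʳ (h x))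

    h-complement : ∀ x → h (complement x) ≈ h x *
    h-complement 𝟘 = ≈-sym (x⇒x≈1 0#)
    h-complement 𝕒 = ≈-refl
    h-complement 𝕓 = ≈-sym a**≈a
    h-complement 𝟙 = ≈-sym (1⇒y≈y 0#)

    h-complemented : ∀ x → h x ∨ h x * ≈ 1#
    h-complemented 𝟘 = ≈-trans (∨-identityˡ _) (x⇒x≈1 0#)
    h-complemented 𝕒 = a∨a*≈1
    h-complemented 𝕓 = ≈-trans (∨-congˡ a**≈a) (≈-trans (∨-comm _ _) a∨a*≈1)
    h-complemented 𝟙 = ∨-zeroˡ _

    h-⇒ : ∀ x y → h (x Four.⇒ y) ≈ (h x ⇒ h y)
    h-⇒ x y = begin-equality
      h (complement x Four.∨ y)  ≈⟨ h-∨ (complement x) y ⟩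
      h (complement x) ∨ h y     ≈⟨ ∨-congʳ (h-complement x) ⟩
      h x * ∨ h y                ≈⟨ complemented-⇒ (h y) (h-complemented x) ⟨
      (h x ⇒ h y)                ∎

    h-′ : ∀ x → h (x Four.′) ≈ h x ′
    h-′ 𝟘 = ≈-sym 0′≈1
    h-′ 𝕒 = a-fixed
    h-′ 𝕓 = a*-fixed
    h-′ 𝟙 = ≈-sym 1′≈0

    h-isHomomorphism : IsHomomorphism (D₂ {c} {ℓ}) B (h ∘ lower)
    h-isHomomorphism = record
      { h-cong = λ { (lift refl) → ≈-refl }
      ; ∨-homo = λ x y → h-∨ (lower x) (lower y)
      ; ∧-homo = λ x y → h-∧ (lower x) (lower y)
      ; ⇒-homo = λ x y → h-⇒ (lower x) (lower y)
      ; ′-homo = λ x → h-′ (lower x)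
      ; 0-homo = ≈-refl
      ; 1-homo = ≈-refl
      }

    -- The hypothesis says y ∨ a ≈ 1, so a * ≤ y, and then
    -- y ≈ y ′ ∨ a * ′ ≈ (y ∧ a *) ′ ≈ a * ′ ≈ a *.
    fixed-disjoint⇒complement : ∀ {y} → Fixed B y → (y ∧ a) ′ ≈ 1# → y ≈ a *
    fixed-disjoint⇒complement {y} y≈y′ [y∧a]′≈1 = begin-equality
      y               ≈⟨ antisym (x≤x∨y _ _) (∨-least ≤-refl a*≤y) ⟩
      y ∨ a *         ≈⟨ ∨-cong y≈y′ a*-fixed ⟩
      y ′ ∨ a * ′     ≈⟨ [x∧y]′≈x′∨y′ y (a *) ⟨
      (y ∧ a *) ′     ≈⟨ ′-cong (antisym (x∧y≤y _ _) (∧-greatest a*≤y ≤-refl)) ⟩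
      a * ′           ≈⟨ a*-fixed ⟨
      a *             ∎
      where
      y∨a≈1 : y ∨ a ≈ 1#
      y∨a≈1 = ≈-trans (∨-cong y≈y′ a-fixed) (≈-trans (≈-sym ([x∧y]′≈x′∨y′ y a)) [y∧a]′≈1)

      a*≤y : a * ≤ y
      a*≤y = x≤y∨z⇒x≤y (≤-trans (maximum _) (≤-reflexive (≈-sym y∨a≈1))) (≈-trans (∧-comm _ _) (x∧x*≈0 a))

    -- If y ′ ≈ 1 then y lies below both a and a *, so y ≈ 0. If y is fixed then
    -- (y ∧ a) ′ ≈ y ∨ a, and the trichotomy for y ∧ a decides between a, a * and 1.
    h-surjective : ∀ {y} → Trichotomous B y → Trichotomous B (y ∨ a) → Trichotomous B (y ∨ a *) →
                   Trichotomous B (y ∧ a) → ∃[ k ] h k ≈ y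
    h-surjective (inj₂ (inj₁ y≈1)) _ _ _ = 𝟙 , ≈-sym y≈1
    h-surjective (inj₂ (inj₂ y′≈1)) y∨a y∨a* _ = 𝟘 , ≈-sym (≤0⇒≈0 (≤-trans
      (∧-greatest (x′≈1⇒x≤fixed a-fixed y′≈1 y∨a) (x′≈1⇒x≤fixed a*-fixed y′≈1 y∨a*))
      (≤-reflexive (x∧x*≈0 a))))
    h-surjective {y} (inj₁ y≈y′) _ _ (inj₁ fixed) = 𝕒 , antisym
      (≤-trans (y≤x∨y y a) (≤-trans (≤-reflexive y∨a≈y∧a) (x∧y≤x y a)))
      (≤-trans (x≤x∨y y a) (≤-trans (≤-reflexive y∨a≈y∧a) (x∧y≤y y a)))
      where
      y∨a≈y∧a : y ∨ a ≈ y ∧ a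
      y∨a≈y∧a = ≈-trans (∨-cong y≈y′ a-fixed) (≈-trans (≈-sym ([x∧y]′≈x′∨y′ y a)) (≈-sym fixed))
    h-surjective {y} _ _ _ (inj₂ (inj₁ y∧a≈1)) =
      𝟙 , ≈-sym (1≤⇒≈1 (≤-trans (≤-reflexive (≈-sym y∧a≈1)) (x∧y≤x y a)))
    h-surjective (inj₁ y≈y′) _ _ (inj₂ (inj₂ [y∧a]′≈1)) = 𝕓 , ≈-sym (fixed-disjoint⇒complement y≈y′ [y∧a]′≈1)

-- Local validity and recombination
module Saturation (A : DQDAlgebra c ℓ) where
  open DQDAlgebra A

  -- One round of closing a list under the binary operations.
  saturate : List Carrier → List Carrier
  saturate xs = xs ++ cartesianProductWith _∧_ xs xs ++ cartesianProductWith _∨_ xs xs ++ cartesianProductWith _⇒_ xs xs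

  module _ (xs : List Carrier) where

    saturate⁺ : ∀ {x} → x ∈ xs → x ∈ saturate xs
    saturate⁺ = ∈-++⁺ˡ

    saturate-∧ : ∀ {x y} → x ∈ xs → y ∈ xs → x ∧ y ∈ saturate xs
    saturate-∧ x∈ y∈ = ∈-++⁺ʳ xs (∈-++⁺ˡ (∈-cartesianProductWith⁺ _∧_ x∈ y∈))

    saturate-∨ : ∀ {x y} → x ∈ xs → y ∈ xs → x ∨ y ∈ saturate xs
    saturate-∨ x∈ y∈ = ∈-++⁺ʳ xs (∈-++⁺ʳ (cartesianProductWith _∧_ xs xs) (∈-++⁺ˡ (∈-cartesianProductWith⁺ _∨_ x∈ y∈)))

    saturate-⇒ : ∀ {x y} → x ∈ xs → y ∈ xs → (x ⇒ y) ∈ saturate xs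
    saturate-⇒ x∈ y∈ = ∈-++⁺ʳ xs (∈-++⁺ʳ (cartesianProductWith _∧_ xs xs) (∈-++⁺ʳ (cartesianProductWith _∨_ xs xs)
      (∈-cartesianProductWith⁺ _⇒_ x∈ y∈)))

  -- 0, 1 and the values of the variables of the identity s ≈ₜ t.
  generators : Term → Term → (ℕ → Carrier) → List Carrier
  generators s t ρ = 0# ∷ 1# ∷ map ρ (vars s ++ vars t)

  -- Three rounds suffice: a fixed point a is looked for after one round, so that
  -- its absence covers the implications between generators; a * occurs after two,
  -- and the elements y ∨ a * needed to locate a generator y after three.
  tests : Term → Term → (ℕ → Carrier) → List Carrier
  tests s t ρ = saturate (saturate (saturate (generators s t ρ)))

Any⊎All : ∀ {a p q} {A : Set a} {P : Pred A p} {Q : Pred A q} {xs : List A} →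
          All (λ x → P x ⊎ Q x) xs → Any P xs ⊎ All Q xs
Any⊎All []                = inj₂ []
Any⊎All (inj₁ px ∷ _)     = inj₁ (here px)
Any⊎All (inj₂ qx ∷ pqxs) = Sum.map there (qx ∷_) (Any⊎All pqxs)

module _ {s t : Term}
         (chains⊨ : ∀ {C : DQDAlgebra c ℓ} → IsDuallyStoneHeytingChain C → C ⊨ (s ≈ₜ t))
         (D₂⊨ : D₂ {c} {ℓ} ⊨ (s ≈ₜ t)) where

  -- An algebra of JIDL₁ in which the test elements are trichotomous satisfies the
  -- identity at ρ, by one of the two cases.
  trichotomous⇒⟦⟧≈ : (B : DQDAlgebra c ℓ) → JIDL₁ B →
    ∀ ρ → All (Trichotomous B) (Saturation.tests B s t ρ) →
    DQDAlgebra._≈_ B (⟦_⟧ B s ρ) (⟦_⟧ B t ρ)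
  trichotomous⇒⟦⟧≈ B B∈JIDL₁ ρ tris = conclude (Any⊎All (All.tabulate λ x∈ → tri (saturate⁺ G₂ (saturate⁺ G₁ x∈))))
    where
    open DQDAlgebra B
    open Saturation B
    open JIDL₁Facts B B∈JIDL₁ using (_*)
    open FixedCase B B∈JIDL₁

    G  = generators s t ρ
    G₁ = saturate G
    G₂ = saturate G₁

    tri : ∀ {x} → x ∈ saturate G₂ → Trichotomous B x
    tri = All.lookup tris

    ρ∈G : ∀ {n} → n ∈ vars s ++ vars t → ρ n ∈ G
    ρ∈G n∈ = there (there (∈-map⁺ ρ n∈))

    conclude : Any (Fixed B) G₁ ⊎ All (Extremal B) G₁ → ⟦_⟧ B s ρ ≈ ⟦_⟧ B t ρ
    conclude (inj₂ extremal) = ExtremalCase.chain⊨⇒⟦⟧≈ B B∈JIDL₁ (_∈ G) (here refl) (there (here refl))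
      (λ x∈ → All.lookup extremal (saturate⁺ G x∈))
      (λ x∈ y∈ → All.lookup extremal (saturate-⇒ G x∈ y∈))
      {s} {t} chains⊨ ρ∈G
    conclude (inj₁ fixed) with find fixed
    ... | a , a∈ , a-fixed =
      Homomorphism.transfer (h-isHomomorphism a-fixed a*-fixed) {s} {t} D₂⊨ λ n∈ →
        let y∈    = saturate⁺ G (ρ∈G n∈)
            k , e = h-surjective a-fixed a*-fixed
              (tri (saturate⁺ G₂ (saturate⁺ G₁ y∈)))
              (tri (saturate⁺ G₂ (saturate-∨ G₁ y∈ a∈)))
              (tri (saturate-∨ G₂ (saturate⁺ G₁ y∈) a*∈))
              (tri (saturate⁺ G₂ (saturate-∧ G₁ y∈ a∈)))
        in lift k , e
      where
      a*∈ : a * ∈ G₂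
      a*∈ = saturate-⇒ G₁ a∈ (saturate⁺ G (here refl))

      a*-fixed : Fixed B (a *)
      a*-fixed = *-fixed a-fixed (tri (saturate⁺ G₂ a*∈))

  JIDL₁⊨ : {A : DQDAlgebra c ℓ} → JIDL₁ A → A ⊨ (s ≈ₜ t)
  JIDL₁⊨ {A} A∈JIDL₁ ρ = ≈[1]⇒≈ (locally-all-trichotomous (tests s t ρ) 1-central λ ce tris →
      ≈-trans (eval ce s) (≈-trans (trichotomous⇒⟦⟧≈ (_ / ce) (/-JIDL₁ ce) ρ tris) (≈-sym (eval ce t))))
    where
    open DQDAlgebra A
    open Saturation A
    open Localisation A A∈JIDL₁

    projection : ∀ {e} (ce : IsCentral A e) → IsHomomorphism A (e / ce) id
    projection ce = record
      { h-cong = ≈⇒≈[]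
      ; ∨-homo = λ _ _ → ≈-refl
      ; ∧-homo = λ _ _ → ≈-refl
      ; ⇒-homo = λ _ _ → ≈-refl
      ; ′-homo = λ _ → ≈-refl
      ; 0-homo = ≈-refl
      ; 1-homo = ≈-refl
      }

    eval : ∀ {e} (ce : IsCentral A e) r → ⟦_⟧ A r ρ ≈[ e ] ⟦_⟧ (e / ce) r ρ
    eval ce r = Homomorphism.⟦⟧-homo (projection ce) r λ _ → DQDAlgebra.≈-refl (_ / ce)

JIDL₁⊆DStHC∨V⟨D₂⟩ : JIDL₁ {c} {ℓ} ⊆ (DStHC {c} {ℓ} ∨ᵛ V ｛ D₂ {c} {ℓ} ｝)
JIDL₁⊆DStHC∨V⟨D₂⟩ {x = A} A∈JIDL₁ Γ K⊨Γ (s ≈ₜ t) e∈Γ = JIDL₁⊨ {s = s} {t = t}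
  (λ {C} C-chain → K⊨Γ {C} (inj₁ (V-contains IsDuallyStoneHeytingChain C-chain)) (s ≈ₜ t) e∈Γ)
  (K⊨Γ {D₂} (inj₂ (V-contains ｛ D₂ ｝ refl)) (s ≈ₜ t) e∈Γ)
  {A = A} A∈JIDL₁

-- The generators of the join belong to JIDL₁
JIDL₁-isVariety : IsVariety _ (JIDL₁ {c} {ℓ})
JIDL₁-isVariety = JIDL₁-Identities , (λ {_} → id) , (λ {_} → id)

chain∈JIDL₁ : {A : DQDAlgebra c ℓ} → IsDuallyStoneHeytingChain A → JIDL₁ A
chain∈JIDL₁ {A = A} A-chain = satisfies
  where
  open DQDAlgebra A hiding (_≤_)
  open BoundedLatticeFacts A
  open IsDuallyStoneHeytingChain A-chain
  open HeytingFacts A heyting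
  open ≤-Reasoning poset

  -- Comparing x ′ with x ′ ′, whose meet is 0, makes one of them 0; in the second
  -- case x ′ ≈ x ′ ′ ′ ≈ 1.
  ′-two-valued : ∀ x → x ′ ≈ 0# ⊎ x ′ ≈ 1#
  ′-two-valued x with chain (x ′) (x ′ ′)
  ... | inj₁ x′∧x″≈x′ = inj₁ (≈-trans (≈-sym x′∧x″≈x′) (duallyStone x))
  ... | inj₂ x″∧x′≈x″ = inj₂ (≈-trans (≈-sym (x‴≈x′ x)) (≈-trans (′-cong x″≈0) 0′≈1))
    where
    x″≈0 : x ′ ′ ≈ 0#
    x″≈0 = ≈-trans (≈-sym x″∧x′≈x″) (≈-trans (∧-comm _ _) (duallyStone x))

  extremal : ∀ x → x ≈ 1# ⊎ x ′ ≈ 1#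
  extremal x = Sum.map₁ (λ x′≈0 → 1≤⇒≈1 (≤-trans (≤-reflexive (≈-sym (≈-trans (′-cong x′≈0) 0′≈1))) (″-deflationary x)))
                  (′-two-valued x)

  1*≈0 : 1# * ≈ 0#
  1*≈0 = 1⇒y≈y 0#

  1′*≈1 : 1# ′ * ≈ 1#
  1′*≈1 = ≈-trans (⇒-cong 1′≈0 ≈-refl) (x⇒x≈1 0#)

  distrib : ∀ p y z → p ≈ 0# ⊎ p ≈ 1# → p ∨ (y ⇒ z) ≈ (p ∨ y ⇒ p ∨ z)
  distrib p y z (inj₁ p≈0) = begin-equality
    p ∨ (y ⇒ z)        ≈⟨ 0-unit (y ⇒ z) ⟩
    (y ⇒ z)            ≈⟨ ⇒-cong (0-unit y) (0-unit z) ⟨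
    (p ∨ y ⇒ p ∨ z)    ∎
    where
    0-unit : ∀ w → p ∨ w ≈ w
    0-unit w = ≈-trans (∨-congʳ p≈0) (∨-identityˡ w)
  distrib p y z (inj₂ p≈1) = begin-equality
    p ∨ (y ⇒ z)        ≈⟨ 1-zero (y ⇒ z) ⟩
    1#                 ≈⟨ x⇒x≈1 1# ⟨
    (1# ⇒ 1#)          ≈⟨ ⇒-cong (1-zero y) (1-zero z) ⟨
    (p ∨ y ⇒ p ∨ z)    ∎
    where
    1-zero : ∀ w → p ∨ w ≈ 1#
    1-zero w = ≈-trans (∨-congʳ p≈1) (∨-zeroˡ w)

  prelinearity : ∀ x y → (x ⇒ y) ∨ (y ⇒ x) ≈ 1#
  prelinearity x y with chain x y
  ... | inj₁ x≤y = ≈-trans (∨-congʳ (≤⇒⇒≈1 (≈-sym x≤y))) (∨-zeroˡ _)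
  ... | inj₂ y≤x = ≈-trans (∨-congˡ (≤⇒⇒≈1 (≈-sym y≤x))) (∨-zeroʳ _)

  level-one : ∀ x → x ∧ x ′ * ≈ (x ∧ x ′ *) ′ *
  level-one x with extremal x
  ... | inj₁ x≈1 = ≈-trans p≈1 (≈-sym (≈-trans (⇒-cong (′-cong p≈1) ≈-refl) 1′*≈1))
    where
    p≈1 : x ∧ x ′ * ≈ 1#
    p≈1 = ≈-trans (∧-cong x≈1 (≈-trans (⇒-cong (′-cong x≈1) ≈-refl) 1′*≈1)) (∧-idem 1#)
  ... | inj₂ x′≈1 = ≈-trans p≈0 (≈-sym (≈-trans (⇒-cong (≈-trans (′-cong p≈0) 0′≈1) ≈-refl) 1*≈0))
    where
    p≈0 : x ∧ x ′ * ≈ 0#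
    p≈0 = ≈-trans (∧-congˡ (≈-trans (⇒-cong x′≈1 ≈-refl) 1*≈0)) (∧-zeroʳ x)

  satisfies : JIDL₁ A
  satisfies _ ′-∨-distrib-⇒ ρ = distrib _ _ _ (′-two-valued (ρ 0))
  satisfies _ prelinear     ρ = prelinearity (ρ 0) (ρ 1)
  satisfies _ level-1       ρ = level-one (ρ 0)

D₂∈JIDL₁ : JIDL₁ (D₂ {c} {ℓ})
D₂∈JIDL₁ _ ′-∨-distrib-⇒ ρ = lift (cong₂ _,_
    (distrib (proj₁ (lower (ρ 0) ′)) (proj₁ (lower (ρ 1))) (proj₁ (lower (ρ 2))))
    (distrib (proj₂ (lower (ρ 0) ′)) (proj₂ (lower (ρ 1))) (proj₂ (lower (ρ 2)))))
  where
  open Four using (_′)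
  distrib : ∀ p q r → p ∨ᵇ (notᵇ q ∨ᵇ r) ≡ notᵇ (p ∨ᵇ q) ∨ᵇ (p ∨ᵇ r)
  distrib false q r = refl
  distrib true  q r = refl
D₂∈JIDL₁ _ prelinear     ρ = lift (cong₂ _,_
    (total (proj₁ (lower (ρ 0))) (proj₁ (lower (ρ 1))))
    (total (proj₂ (lower (ρ 0))) (proj₂ (lower (ρ 1)))))
  where
  total : ∀ p q → (notᵇ p ∨ᵇ q) ∨ᵇ (notᵇ q ∨ᵇ p) ≡ true
  total false q     = refl
  total true  false = refl
  total true  true  = refl
D₂∈JIDL₁ _ level-1       ρ = lift (level-one (lower (ρ 0)))
  where
  open Four
  level-one : ∀ x → x ∧ (x ′ ⇒ 𝟘) ≡ ((x ∧ (x ′ ⇒ 𝟘)) ′ ⇒ 𝟘)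
  level-one 𝟘 = refl
  level-one a = refl
  level-one b = refl
  level-one 𝟙 = refl

DStHC∨V⟨D₂⟩⊆JIDL₁ : (DStHC {c} {ℓ} ∨ᵛ V ｛ D₂ {c} {ℓ} ｝) ⊆ JIDL₁ {c} {ℓ}
DStHC∨V⟨D₂⟩⊆JIDL₁ {x = A} = ∨ᵛ-least DStHC (V ｛ D₂ ｝) JIDL₁ JIDL₁-isVariety
  (λ {B} → V-least IsDuallyStoneHeytingChain JIDL₁ JIDL₁-isVariety (λ {C} → chain∈JIDL₁ {A = C}) {B})
  (λ {B} → V-least ｛ D₂ ｝ JIDL₁ JIDL₁-isVariety (λ { refl → D₂∈JIDL₁ }) {B})
  {A}

corollary6p8 : ∀ {c ℓ : Level} → JIDL₁ {c} {ℓ} ≐ (DStHC {c} {ℓ} ∨ᵛ V ｛ D₂ {c} {ℓ} ｝)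
corollary6p8 = (λ {A} → JIDL₁⊆DStHC∨V⟨D₂⟩ {x = A}) , (λ {A} → DStHC∨V⟨D₂⟩⊆JIDL₁ {x = A})
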